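{- Let $v>9$ be an integer with $v\equiv 1 \pmod 4$. If there exists an $\mathrm{STS}(v)$ admitting a zero-sum $k$-flow for some integer $k\ge 2$, then there exists an $\mathrm{STS}(2v+7)$ admitting a zero-sum $k$-flow.
   Context: A Steiner triple system $\mathrm{STS}(v)$ is a pair $(X,\mathcal{B})$ where $|X|=v$ and $\mathcal{B}$ is a collection of 3-subsets (blocks) of $X$ such that every 2-subset of $X$ lies in exactly one block. For a design $(X,\mathcal{B})$ and an integer $n\ge 2$, a zero-sum $n$-flow is a map $f:\mathcal{B}\to\{\pm1,\pm2,\ldots,\pm(n-1)\}$ such that for every point $x\in X$, $\sum_{B\in\mathcal{B},\,x\in B} f(B)=0$. -}

module Defs where

open import Data.Fin using (Fin)
open import Data.Fin.Subset using (Subset; _⊆_; ∣_∣)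
open import Data.Fin.Subset.Properties using (_∈?_)
open import Data.Integer as ℤ using (ℤ; 0ℤ)
open import Data.List using (List; allFin; filter; foldr; map)
open import Data.Nat using (ℕ; _<_; _≤_)
open import Data.Product using (_×_; ∃!)
open import Function.Definitions using (Injective)
open import Relation.Binary.PropositionalEquality using (_≡_)

-- The collection 𝓑 is an injectively indexed family, so that it has no
-- repeated blocks and a map out of 𝓑 is a map out of the index set.
record STS (v : ℕ) : Set where
  field
    #blocks         : ℕ
    block           : Fin #blocks → Subset v
    block-injective : Injective _≡_ _≡_ block
    block-size      : ∀ i → ∣ block i ∣ ≡ 3
    pair-covered    : ∀ (p : Subset v) → ∣ p ∣ ≡ 2 → ∃! _≡_ (λ i → p ⊆ block i)

  blocksThrough : Fin v → List (Fin #blocks)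
  blocksThrough x = filter (λ i → x ∈? block i) (allFin #blocks)

record ZeroSumFlow {v : ℕ} (D : STS v) (n : ℕ) : Set where
  open STS D
  field
    flow       : Fin #blocks → ℤ
    -- flow i ∈ {±1, …, ±(n-1)}
    flow-range : ∀ i → 1 ≤ ℤ.∣ flow i ∣ × ℤ.∣ flow i ∣ < n
    zero-sum   : ∀ x → foldr ℤ._+_ 0ℤ (map flow (blocksThrough x)) ≡ 0ℤ

{-# OPTIONS --safe #-}
-- Write v = 4m − 7, so that 2v + 7 = v + 4m, and add the points (h , x) with
-- h in one of four quarters and x in ℤ/m.  Four translation classes of
-- triangles cover a 6-regular graph on the new points; the remaining graph,
-- regular of degree v, splits into v one-factors, and the j-th old point forms
-- a block with every edge of the j-th factor.  The factors are the reflections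
-- x ↦ c − x, which exchange the quarters 0 ↔ 1 and 2 ↔ 3 at difference 0 (and
-- 0 ↔ 1 at ±1 for odd m) and otherwise fix each quarter, and translations that
-- move every quarter by one of the three pairings.
--
-- The old blocks keep their values, and all new blocks get ±1.  Identify the
-- quarters with (ℤ/2)² and let α, β, γ be its nonzero elements.  A factor is
-- signed by ± a nontrivial character χ of (ℤ/2)² that is constant along its
-- edges; χ is balanced, so the sum at every old point is zero.  The triangles
-- are signed so that they contribute − χ α at every new point.  The signs of
-- the factors alternate within each family, and the triangles are chosen,
-- depending on the parity of m, so that the factors contribute + χ α.
module Submission where

open import Defs

-- Finite sums over enumerated sets, and quasigroups carrying a flow

module Summation where

  open import Algebra.Properties.Semiring.Sum as Sum using ()
  open import Data.Fin using (Fin; zero; suc; combine; _↑ˡ_; _↑ʳ_; punchIn)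
  open import Data.Fin.Properties using (+↔⊎; *↔×; splitAt-↑ˡ; splitAt-↑ʳ; remQuot-combine; punchInᵢ≢i)
  open import Data.Integer as ℤ using (ℤ; 0ℤ; _+_)
  import Data.Integer.Properties as ℤₚ
  open import Data.Nat as ℕ using (ℕ; zero; suc)
  open import Data.Product using (_×_; _,_)
  open import Data.Product.Function.NonDependent.Propositional using (_×-↔_)
  open import Data.Sum using (_⊎_; inj₁; inj₂)
  open import Data.Sum.Function.Propositional using (_⊎-↔_)
  open import Function using (_∘_; _↔_; Inverse)
  open import Function.Construct.Composition using (_↔-∘_)
  open import Function.Construct.Symmetry using (↔-sym)
  open import Relation.Binary.PropositionalEquality

  open Inverse using (to; from; strictlyInverseˡ; strictlyInverseʳ) public
  open Sum ℤₚ.+-*-semiring public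
    using (sum; sum-remove; ∑-distrib-+; ∑-comm; sum-permute; *-distribˡ-sum; *-distribʳ-sum; sum-replicate-zero)
  open Sum ℤₚ.+-*-semiring renaming (sum-cong-≗ to sum-cong) using () public

  private variable
    A B : Set
    m n : ℕ

  sum-zero : {f : Fin n → ℤ} → (∀ i → f i ≡ 0ℤ) → sum f ≡ 0ℤ
  sum-zero {n} f≡0 = trans (sum-cong f≡0) (sum-replicate-zero n)

  sum-single : {f : Fin n → ℤ} (i : Fin n) → (∀ j → j ≢ i → f j ≡ 0ℤ) → sum f ≡ f i
  sum-single {suc n} {f} i f≡0 = begin
    sum f                          ≡⟨ sum-remove {i = i} f ⟩
    f i + sum (f ∘ punchIn i)      ≡⟨ cong (f i +_) (sum-zero (λ j → f≡0 _ (punchInᵢ≢i i j))) ⟩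
    f i + 0ℤ                       ≡⟨ ℤₚ.+-identityʳ _ ⟩
    f i                            ∎
    where open ≡-Reasoning

  sum-++ : ∀ m {n} (f : Fin (m ℕ.+ n) → ℤ) → sum f ≡ sum (f ∘ (_↑ˡ n)) + sum (f ∘ (m ↑ʳ_))
  sum-++ zero    f = sym (ℤₚ.+-identityˡ _)
  sum-++ (suc m) f = trans (cong (f zero +_) (sum-++ m (f ∘ suc))) (sym (ℤₚ.+-assoc (f zero) _ _))

  sum-combine : ∀ m {n} (f : Fin (m ℕ.* n) → ℤ) → sum f ≡ sum {m} (λ i → sum {n} (λ j → f (combine i j)))
  sum-combine zero        f = refl
  sum-combine (suc m) {n} f = trans (sum-++ n f) (cong (sum (f ∘ (_↑ˡ m ℕ.* n)) +_) (sum-combine m (f ∘ (n ↑ʳ_))))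

  ∑ : Fin n ↔ A → (A → ℤ) → ℤ
  ∑ e f = sum (f ∘ to e)

  -- Composing the three bijections gives a permutation of indices, so both sides add the same terms
  -- in a different order.
  ∑-reindex : (e : Fin m ↔ A) (e′ : Fin n ↔ B) (φ : A ↔ B) (f : B → ℤ) → ∑ e′ f ≡ ∑ e (f ∘ to φ)
  ∑-reindex e e′ φ f = trans
    (sum-permute (f ∘ to e′) (↔-sym e′ ↔-∘ (φ ↔-∘ e)))
    (sum-cong (λ i → cong f (strictlyInverseˡ e′ (to φ (to e i)))))

  ∑-single : (e : Fin n ↔ A) {f : A → ℤ} (a : A) → (∀ b → b ≢ a → f b ≡ 0ℤ) → ∑ e f ≡ f a
  ∑-single e {f} a f≡0 = trans
    (sum-single (from e a) (λ j j≢ → f≡0 _ (λ eq → j≢ (trans (sym (strictlyInverseʳ e j)) (cong (from e) eq)))))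
    (cong f (strictlyInverseˡ e a))

  infixr 2 _⊎ᶠ_
  infixr 3 _×ᶠ_

  _⊎ᶠ_ : Fin m ↔ A → Fin n ↔ B → Fin (m ℕ.+ n) ↔ (A ⊎ B)
  e ⊎ᶠ e′ = (e ⊎-↔ e′) ↔-∘ +↔⊎

  _×ᶠ_ : Fin m ↔ A → Fin n ↔ B → Fin (m ℕ.* n) ↔ (A × B)
  e ×ᶠ e′ = (e ×-↔ e′) ↔-∘ *↔×

  ∑-⊎ : (e : Fin m ↔ A) (e′ : Fin n ↔ B) (f : A ⊎ B → ℤ) →
        ∑ (e ⊎ᶠ e′) f ≡ ∑ e (f ∘ inj₁) + ∑ e′ (f ∘ inj₂)
  ∑-⊎ {m} {n = n} e e′ f = trans (sum-++ m (f ∘ to (e ⊎ᶠ e′))) (cong₂ _+_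
    (sum-cong (λ i → cong (f ∘ to (e ⊎-↔ e′)) (splitAt-↑ˡ m i n)))
    (sum-cong (λ i → cong (f ∘ to (e ⊎-↔ e′)) (splitAt-↑ʳ m n i))))

  ∑-× : (e : Fin m ↔ A) (e′ : Fin n ↔ B) (f : A × B → ℤ) →
        ∑ (e ×ᶠ e′) f ≡ ∑ e (λ a → ∑ e′ (λ b → f (a , b)))
  ∑-× {m} {n = n} e e′ f = trans (sum-combine m (f ∘ to (e ×ᶠ e′)))
    (sum-cong (λ i → sum-cong (λ j → cong (f ∘ to (e ×-↔ e′)) (remQuot-combine {m} {n} i j))))

  -- A Steiner triple system with a flow: a ∙ b is the third point of the block
  -- through a ≢ b, and w a b is the value of that block.  Row a of w counts every
  -- block through a twice, so w-sum is the zero-sum condition at a.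
  record FlowQuasigroup (k : ℕ) (e : Fin n ↔ A) : Set where
    infixl 7 _∙_
    field
      _∙_      : A → A → A
      idem     : ∀ a → a ∙ a ≡ a
      comm     : ∀ a b → a ∙ b ≡ b ∙ a
      absorb   : ∀ a b → a ∙ (a ∙ b) ≡ b
      w        : A → A → ℤ
      w-diag   : ∀ a → w a a ≡ 0ℤ
      w-sym    : ∀ a b → w a b ≡ w b a
      w-third  : ∀ a b → w a (a ∙ b) ≡ w a b
      w-range  : ∀ {a b} → a ≢ b → 1 ℕ.≤ ℤ.∣ w a b ∣ × ℤ.∣ w a b ∣ ℕ.< k
      w-sum    : ∀ a → ∑ e (w a) ≡ 0ℤ

  transport : ∀ {k} (e : Fin m ↔ A) (e′ : Fin n ↔ B) → A ↔ B → FlowQuasigroup k e → FlowQuasigroup k e′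
  transport e e′ φ F = record
    { _∙_     = λ a b → to φ (ψ a ∙ ψ b)
    ; idem    = λ a → trans (cong (to φ) (idem (ψ a))) (strictlyInverseˡ φ a)
    ; comm    = λ a b → cong (to φ) (comm (ψ a) (ψ b))
    ; absorb  = λ a b → trans (cong (λ c → to φ (ψ a ∙ c)) (strictlyInverseʳ φ _))
                       (trans (cong (to φ) (absorb (ψ a) (ψ b))) (strictlyInverseˡ φ b))
    ; w       = λ a b → w (ψ a) (ψ b)
    ; w-diag  = λ a → w-diag (ψ a)
    ; w-sym   = λ a b → w-sym (ψ a) (ψ b)
    ; w-third = λ a b → trans (cong (w (ψ a)) (strictlyInverseʳ φ _)) (w-third (ψ a) (ψ b))
    ; w-range = λ a≢b → w-range (λ eq → a≢b (trans (sym (strictlyInverseˡ φ _))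
                                              (trans (cong (to φ) eq) (strictlyInverseˡ φ _))))
    ; w-sum   = λ a → trans (sym (∑-reindex e′ e (↔-sym φ) (w (ψ a)))) (w-sum (ψ a))
    }
    where
    open FlowQuasigroup F
    ψ = from φ

-- Passage between designs with flows and flow quasigroups

module Designs where

  open Summation
  open import Data.Bool using (true; false; if_then_else_)
  open import Data.Empty using (⊥-elim)
  open import Data.Fin using (Fin; zero; suc; _<_; _<?_)
  open import Data.Fin.Properties using (_≟_; <-cmp; <-asym; <-irrefl; <-trans)
  open import Data.Fin.Subset using (Subset; inside; outside; _∈_; _∉_; _⊆_; _∪_; _-_; ⁅_⁆; ∣_∣)
  open import Data.Fin.Subset.Properties
    using (_∈?_; p─q⊆p; p─⊥≡p; x∈p∧x≢y⇒x∈p-y; x∈⁅x⁆; x∈⁅y⁆⇒x≡y; ∣⁅x⁆∣≡1; x∈p∪q⁻; x∈p∪q⁺; ∪-identityˡ)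
  open import Data.Integer as ℤ using (ℤ; 0ℤ; _+_; _*_)
  import Data.Integer.Properties as ℤₚ
  open import Data.List using (List; []; _∷_; allFin; filter; foldr; length; lookup; map; tabulate; cartesianProduct)
  open import Data.List.Membership.Propositional.Properties using (∈-filter⁺; ∈-filter⁻; ∈-cartesianProduct⁺; ∈-allFin; ∈-lookup)
  import Data.List.Relation.Unary.All as All
  open import Data.List.Relation.Unary.AllPairs using (_∷_)
  open import Data.List.Relation.Unary.Any using (index)
  open import Data.List.Relation.Unary.Any.Properties using (lookup-index)
  open import Data.List.Relation.Unary.Unique.Propositional using (Unique)
  open import Data.List.Relation.Unary.Unique.Propositional.Properties using (filter⁺; cartesianProduct⁺; allFin⁺)
  open import Data.Nat as ℕ using (ℕ; zero; suc)
  open import Data.Product using (_×_; _,_; ∃; ∃₂; ∃!; proj₁; proj₂; uncurry)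
  open import Data.Product.Properties using (×-≡,≡→≡)
  open import Data.Sum using (_⊎_; inj₁; inj₂; [_,_]′)
  open import Data.Vec using (_∷_; [])
  open import Data.Vec.Base using (here; there)
  open import Function using (_∘_; id)
  open import Function.Construct.Identity using (↔-id)
  open import Relation.Binary.Definitions using (tri<; tri≈; tri>)
  open import Relation.Binary.PropositionalEquality
  open import Relation.Nullary using (¬_; Dec; does; yes; no; _×-dec_)
  open import Relation.Nullary.Decidable using (dec-true)
  open import Relation.Unary using (Decidable)

  private variable
    n : ℕ

  ∣p∣≡suc∣p-x∣ : {p : Subset n} {x : Fin n} → x ∈ p → ∣ p ∣ ≡ suc ∣ p - x ∣
  ∣p∣≡suc∣p-x∣ {p = inside  ∷ p} here        = cong (suc ∘ ∣_∣) (sym (p─⊥≡p p))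
  ∣p∣≡suc∣p-x∣ {p = inside  ∷ p} (there x∈p) = cong suc (∣p∣≡suc∣p-x∣ x∈p)
  ∣p∣≡suc∣p-x∣ {p = outside ∷ p} (there x∈p) = ∣p∣≡suc∣p-x∣ x∈p

  ∈-remove⁻ : (p : Subset n) {x y : Fin n} → x ∈ p - y → x ∈ p × x ≢ y
  ∈-remove⁻ p {y = y} x∈ = p─q⊆p p ⁅ y ⁆ x∈ , λ { refl → x∉p-x p y x∈ }
    where
    x∉p-x : (p : Subset n) (x : Fin n) → x ∉ p - x
    x∉p-x (inside  ∷ p) zero    ()
    x∉p-x (outside ∷ p) zero    ()
    x∉p-x (_       ∷ p) (suc x) (there x∈) = x∉p-x p x x∈

  ∣p∣≡0⇒∉ : {p : Subset n} → ∣ p ∣ ≡ 0 → ∀ x → x ∉ p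
  ∣p∣≡0⇒∉ ∣p∣≡0 x x∈p with () ← trans (sym ∣p∣≡0) (∣p∣≡suc∣p-x∣ x∈p)

  ∣p∣≡suc⇒∃ : (p : Subset n) {m : ℕ} → ∣ p ∣ ≡ suc m → ∃ λ x → x ∈ p × ∣ p - x ∣ ≡ m
  ∣p∣≡suc⇒∃ (inside ∷ p) refl = zero , here , cong ∣_∣ (p─⊥≡p p)
  ∣p∣≡suc⇒∃ (outside ∷ p) eq with ∣p∣≡suc⇒∃ p eq
  ... | x , x∈p , eq′ = suc x , there x∈p , eq′

  ∣⁅x⁆∪p∣ : {p : Subset n} (x : Fin n) → x ∉ p → ∣ ⁅ x ⁆ ∪ p ∣ ≡ suc ∣ p ∣
  ∣⁅x⁆∪p∣ {p = inside  ∷ p} zero    x∉p = ⊥-elim (x∉p here)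
  ∣⁅x⁆∪p∣ {p = outside ∷ p} zero    x∉p = cong (suc ∘ ∣_∣) (∪-identityˡ p)
  ∣⁅x⁆∪p∣ {p = inside  ∷ p} (suc x) x∉p = cong suc (∣⁅x⁆∪p∣ x (x∉p ∘ there))
  ∣⁅x⁆∪p∣ {p = outside ∷ p} (suc x) x∉p = ∣⁅x⁆∪p∣ x (x∉p ∘ there)

  ∣⁅x,y⁆∣≡2 : {x y : Fin n} → x ≢ y → ∣ ⁅ x ⁆ ∪ ⁅ y ⁆ ∣ ≡ 2
  ∣⁅x,y⁆∣≡2 {x = x} {y} x≢y = trans (∣⁅x⁆∪p∣ x (x≢y ∘ x∈⁅y⁆⇒x≡y y)) (cong suc (∣⁅x⁆∣≡1 y))

  ∈-pair⁻ : {x y z : Fin n} → z ∈ ⁅ x ⁆ ∪ ⁅ y ⁆ → z ≡ x ⊎ z ≡ y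
  ∈-pair⁻ {x = x} {y} z∈ with x∈p∪q⁻ ⁅ x ⁆ ⁅ y ⁆ z∈
  ... | inj₁ z∈x = inj₁ (x∈⁅y⁆⇒x≡y x z∈x)
  ... | inj₂ z∈y = inj₂ (x∈⁅y⁆⇒x≡y y z∈y)

  -- Removing x and y from a 3-set leaves a set of size one; its element is `z`.
  third : (p : Subset n) → ∣ p ∣ ≡ 3 → ∀ {x y} → x ∈ p → y ∈ p → x ≢ y →
          ∃ λ z → z ∈ p × z ≢ x × z ≢ y × (∀ {u} → u ∈ p → u ≢ x → u ≢ y → u ≡ z)
  third p ∣p∣≡3 {x} {y} x∈p y∈p x≢y = z , z∈p , z≢x , z≢y , unique
    where
    q = p - x - y
    ∣q∣≡1 : ∣ q ∣ ≡ 1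
    ∣q∣≡1 = cong (ℕ.pred ∘ ℕ.pred) (trans (sym (trans (∣p∣≡suc∣p-x∣ x∈p)
      (cong suc (∣p∣≡suc∣p-x∣ (x∈p∧x≢y⇒x∈p-y y∈p (x≢y ∘ sym)))))) ∣p∣≡3)
    ∃z = ∣p∣≡suc⇒∃ q ∣q∣≡1
    z = proj₁ ∃z
    z∈p-x = ∈-remove⁻ (p - x) (proj₁ (proj₂ ∃z))
    z≢y = proj₂ z∈p-x
    z∈p = proj₁ (∈-remove⁻ p (proj₁ z∈p-x))
    z≢x = proj₂ (∈-remove⁻ p (proj₁ z∈p-x))
    unique : ∀ {u} → u ∈ p → u ≢ x → u ≢ y → u ≡ z
    unique {u} u∈p u≢x u≢y with u ≟ z
    ... | yes u≡z = u≡z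
    ... | no  u≢z = ⊥-elim (∣p∣≡0⇒∉ (proj₂ (proj₂ ∃z)) u
      (x∈p∧x≢y⇒x∈p-y (x∈p∧x≢y⇒x∈p-y (x∈p∧x≢y⇒x∈p-y u∈p u≢x) u≢y) u≢z))

  if-yes : ∀ {P A : Set} (P? : Dec P) {x y : A} → P → (if does P? then x else y) ≡ x
  if-yes P? p = cong (if_then _ else _) (dec-true P? p)

  sum-∈ : (p : Subset n) (c : ℤ) → sum (λ x → if does (x ∈? p) then c else 0ℤ) ≡ ℤ.+ ∣ p ∣ * c
  sum-∈ []            c = sym (ℤₚ.*-zeroˡ c)
  sum-∈ (inside  ∷ p) c = trans (cong (c +_) (sum-∈ p c)) (sym (ℤₚ.suc-* (ℤ.+ ∣ p ∣) c))
  sum-∈ (outside ∷ p) c = trans (ℤₚ.+-identityˡ _) (sum-∈ p c)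

  -- Counting rejected entries as zero turns the list sum used in `zero-sum` into an indexed sum,
  -- where the order of summation can be exchanged.
  foldr-filter : ∀ {A : Set} {P : A → Set} (P? : Decidable P) (f : A → ℤ) (g : Fin n → A) →
    foldr _+_ 0ℤ (map f (filter P? (tabulate g))) ≡ sum (λ i → if does (P? (g i)) then f (g i) else 0ℤ)
  foldr-filter {zero}  P? f g = refl
  foldr-filter {suc n} P? f g with does (P? (g zero))
  ... | true  = cong (_+_ (f (g zero))) (foldr-filter P? f (g ∘ suc))
  ... | false = trans (foldr-filter P? f (g ∘ suc)) (sym (ℤₚ.+-identityˡ _))

  module Cover {v} (D : STS v) where
    open STS D

    cover : ∀ {a b} → a ≢ b → ∃ λ i → a ∈ block i × b ∈ block i
    cover {a} {b} a≢b with pair-covered (⁅ a ⁆ ∪ ⁅ b ⁆) (∣⁅x,y⁆∣≡2 a≢b)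
    ... | i , ⊆i , _ = i , ⊆i (x∈p∪q⁺ (inj₁ (x∈⁅x⁆ a))) , ⊆i (x∈p∪q⁺ (inj₂ (x∈⁅x⁆ b)))

    cover-unique : ∀ {a b i j} → a ≢ b → a ∈ block i → b ∈ block i → a ∈ block j → b ∈ block j → i ≡ j
    cover-unique {a} {b} {i} {j} a≢b a∈i b∈i a∈j b∈j with pair-covered (⁅ a ⁆ ∪ ⁅ b ⁆) (∣⁅x,y⁆∣≡2 a≢b)
    ... | _ , _ , unique = trans (sym (unique (⊆block a∈i b∈i))) (unique (⊆block a∈j b∈j))
      where
      ⊆block : ∀ {i} → a ∈ block i → b ∈ block i → ⁅ a ⁆ ∪ ⁅ b ⁆ ⊆ block i
      ⊆block a∈ b∈ z∈ with ∈-pair⁻ z∈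
      ... | inj₁ refl = a∈
      ... | inj₂ refl = b∈

    blockSum : (Fin #blocks → ℤ) → Fin v → ℤ
    blockSum f a = foldr _+_ 0ℤ (map f (blocksThrough a))

    -- Every block through a contributes its value once for each of its two other points.
    sum-pairs : (f : Fin #blocks → ℤ) (w : Fin v → Fin v → ℤ) → (∀ a → w a a ≡ 0ℤ) →
                (∀ i {a b} → a ∈ block i → b ∈ block i → a ≢ b → w a b ≡ f i) →
                ∀ a → sum (w a) ≡ ℤ.+ 2 * blockSum f a
    sum-pairs f w w-diag w-block a = begin
      sum (w a)                                     ≡⟨ sum-cong split ⟩
      sum (λ b → sum (λ i → c i b))                 ≡⟨ ∑-comm (λ b i → c i b) ⟩
      sum (λ i → sum (λ b → c i b))                 ≡⟨ sum-cong inner ⟩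
      sum (λ i → ℤ.+ 2 * g i)                         ≡⟨ *-distribˡ-sum (ℤ.+ 2) g ⟨
      ℤ.+ 2 * sum g                                   ≡⟨ cong (ℤ.+ 2 *_) (foldr-filter (λ i → a ∈? block i) f id) ⟨
      ℤ.+ 2 * blockSum f a                            ∎
      where
      open ≡-Reasoning
      g : Fin #blocks → ℤ
      g i = if does (a ∈? block i) then f i else 0ℤ
      -- `c i b` is `f i` if a and b are distinct points of block i, and zero otherwise. For fixed b
      -- ≢ a only the block covering the pair survives; for a fixed block through a exactly two b
      -- survive.
      c : Fin #blocks → Fin v → ℤ
      c i b = if does (b ∈? block i - a) then g i else 0ℤ

      c-zero : ∀ i b → (a ∈ block i → b ∈ block i → ¬ (a ≢ b)) → c i b ≡ 0ℤ
      c-zero i b ¬ab with b ∈? block i - a | a ∈? block i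
      ... | no _ | _ = refl
      ... | yes _ | no _ = refl
      ... | yes b∈ | yes a∈ with ∈-remove⁻ (block i) b∈
      ...   | b∈i , b≢a = ⊥-elim (¬ab a∈ b∈i (b≢a ∘ sym))

      split : ∀ b → w a b ≡ sum (λ i → c i b)
      split b with a ≟ b
      ... | yes refl = trans (w-diag a) (sym (sum-zero (λ i → c-zero i a (λ _ _ a≢a → a≢a refl))))
      ... | no a≢b with cover a≢b
      ...   | i , a∈i , b∈i = trans (w-block i a∈i b∈i a≢b) (sym (trans
        (sum-single i (λ j j≢i → c-zero j b (λ a∈j b∈j _ → j≢i (cover-unique a≢b a∈j b∈j a∈i b∈i))))
        (trans (if-yes (b ∈? block i - a) (x∈p∧x≢y⇒x∈p-y b∈i (a≢b ∘ sym))) (if-yes (a ∈? block i) a∈i))))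

      inner : ∀ i → sum (λ b → c i b) ≡ ℤ.+ 2 * g i
      inner i with a ∈? block i
      ... | yes a∈i = trans (sum-∈ (block i - a) (f i))
        (cong (λ m → ℤ.+ m * f i) (cong ℕ.pred (trans (sym (∣p∣≡suc∣p-x∣ a∈i)) (block-size i))))
      ... | no _ = sum-zero (λ b → if-same (does (b ∈? block i - a)))
        where
        if-same : ∀ t → (if t then 0ℤ else 0ℤ) ≡ 0ℤ
        if-same true = refl
        if-same false = refl

  -- From a design to its quasigroup

  module _ {v k} (D : STS v) (F : ZeroSumFlow D k) where
    open STS D
    open ZeroSumFlow F
    open Cover D

    private
      -- Together with `a ≢ b` this treats the three points alike, so commutativity and absorption
      -- follow by permuting them, because two points determine the third.
      record Third (a b c : Fin v) : Set where
        constructor mkThird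
        field
          {i}     : Fin #blocks
          a∈ : a ∈ block i
          b∈ : b ∈ block i
          c∈ : c ∈ block i
          c≢a : c ≢ a
          c≢b : c ≢ b

      Third-unique : ∀ {a b c c′} → a ≢ b → Third a b c → Third a b c′ → c ≡ c′
      Third-unique {c = c} {c′} a≢b (mkThird {i} a∈ b∈ c∈ c≢a c≢b) (mkThird {j} a∈′ b∈′ c∈′ c′≢a c′≢b)
        with refl ← cover-unique a≢b a∈ b∈ a∈′ b∈′ | third (block i) (block-size i) a∈ b∈ a≢b
      ... | _ , _ , _ , _ , unique = trans (unique c∈ c≢a c≢b) (sym (unique c∈′ c′≢a c′≢b))

      ∃Third : ∀ {a b} → a ≢ b → ∃ (Third a b)
      ∃Third a≢b with cover a≢b
      ... | i , a∈ , b∈ with third (block i) (block-size i) a∈ b∈ a≢b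
      ...   | c , c∈ , c≢a , c≢b , _ = c , mkThird a∈ b∈ c∈ c≢a c≢b

      op : Fin v → Fin v → Fin v
      op a b with a ≟ b
      ... | yes _  = a
      ... | no a≢b = proj₁ (∃Third a≢b)

      op-third : ∀ {a b} → a ≢ b → Third a b (op a b)
      op-third {a} {b} a≢b with a ≟ b
      ... | yes a≡b = ⊥-elim (a≢b a≡b)
      ... | no a≢b′ = proj₂ (∃Third a≢b′)

      op-unique : ∀ {a b c} → a ≢ b → Third a b c → op a b ≡ c
      op-unique a≢b = Third-unique a≢b (op-third a≢b)

      op-idem : ∀ a → op a a ≡ a
      op-idem a with a ≟ a
      ... | yes _  = refl
      ... | no a≢a = ⊥-elim (a≢a refl)

      wt : Fin v → Fin v → ℤ
      wt a b with a ≟ b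
      ... | yes _  = 0ℤ
      ... | no a≢b = flow (proj₁ (cover a≢b))

      wt-diag : ∀ a → wt a a ≡ 0ℤ
      wt-diag a with a ≟ a
      ... | yes _  = refl
      ... | no a≢a = ⊥-elim (a≢a refl)

      wt-block : ∀ i {a b} → a ∈ block i → b ∈ block i → a ≢ b → wt a b ≡ flow i
      wt-block i {a} {b} a∈ b∈ a≢b with a ≟ b
      ... | yes a≡b = ⊥-elim (a≢b a≡b)
      ... | no a≢b  = cong flow (cover-unique a≢b (proj₁ (proj₂ (cover a≢b))) (proj₂ (proj₂ (cover a≢b))) a∈ b∈)

      Third-comm : ∀ {a b c} → Third a b c → Third b a c
      Third-comm (mkThird a∈ b∈ c∈ c≢a c≢b) = mkThird b∈ a∈ c∈ c≢b c≢a

      Third-swap : ∀ {a b c} → a ≢ b → Third a b c → Third a c b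
      Third-swap a≢b (mkThird a∈ b∈ c∈ c≢a c≢b) = mkThird a∈ c∈ b∈ (a≢b ∘ sym) (c≢b ∘ sym)

      op-comm : ∀ a b → op a b ≡ op b a
      op-comm a b = by-cases (a ≟ b)
        where
        by-cases : Dec (a ≡ b) → op a b ≡ op b a
        by-cases (yes refl) = refl
        by-cases (no a≢b)   = op-unique a≢b (Third-comm (op-third (a≢b ∘ sym)))

      op-absorb : ∀ a b → op a (op a b) ≡ b
      op-absorb a b = by-cases (a ≟ b)
        where
        by-cases : Dec (a ≡ b) → op a (op a b) ≡ b
        by-cases (yes refl) = trans (cong (op a) (op-idem a)) (op-idem a)
        by-cases (no a≢b)   = op-unique (Third.c≢a (op-third a≢b) ∘ sym) (Third-swap a≢b (op-third a≢b))

      wt-cover : ∀ {a b} (a≢b : a ≢ b) → wt a b ≡ flow (proj₁ (cover a≢b))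
      wt-cover a≢b = wt-block _ (proj₁ (proj₂ (cover a≢b))) (proj₂ (proj₂ (cover a≢b))) a≢b

      wt-sym : ∀ a b → wt a b ≡ wt b a
      wt-sym a b = by-cases (a ≟ b)
        where
        by-cases : Dec (a ≡ b) → wt a b ≡ wt b a
        by-cases (yes refl) = refl
        by-cases (no a≢b)   = trans (wt-cover a≢b)
          (sym (wt-block _ (proj₂ (proj₂ (cover a≢b))) (proj₁ (proj₂ (cover a≢b))) (a≢b ∘ sym)))

      wt-third : ∀ a b → wt a (op a b) ≡ wt a b
      wt-third a b = by-cases (a ≟ b)
        where
        by-cases : Dec (a ≡ b) → wt a (op a b) ≡ wt a b
        by-cases (yes refl) = cong (wt a) (op-idem a)
        by-cases (no a≢b) with op-third a≢b
        ... | mkThird a∈ b∈ c∈ c≢a c≢b = trans (wt-block _ a∈ c∈ (c≢a ∘ sym)) (sym (wt-block _ a∈ b∈ a≢b))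

      wt-range : ∀ {a b} → a ≢ b → 1 ℕ.≤ ℤ.∣ wt a b ∣ × ℤ.∣ wt a b ∣ ℕ.< k
      wt-range {a} {b} a≢b with a ≟ b
      ... | yes a≡b = ⊥-elim (a≢b a≡b)
      ... | no a≢b = flow-range _

    quasigroup : FlowQuasigroup k (↔-id (Fin v))
    quasigroup = record
      { _∙_ = op ; idem = op-idem ; comm = op-comm ; absorb = op-absorb
      ; w = wt ; w-diag = wt-diag ; w-sym = wt-sym ; w-third = wt-third ; w-range = wt-range
      ; w-sum = λ a → trans (sum-pairs flow wt wt-diag wt-block a) (cong (ℤ.+ 2 *_) (zero-sum a)) }

  lookup-injective : ∀ {A : Set} {xs : List A} → Unique xs → ∀ i j → lookup xs i ≡ lookup xs j → i ≡ j
  lookup-injective (x∉ ∷ _) zero    zero    _  = refl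
  lookup-injective (x∉ ∷ _) zero    (suc j) eq = ⊥-elim (All.lookup x∉ (∈-lookup j) eq)
  lookup-injective (x∉ ∷ _) (suc i) zero    eq = ⊥-elim (All.lookup x∉ (∈-lookup i) (sym eq))
  lookup-injective (_ ∷ uq) (suc i) (suc j) eq = cong suc (lookup-injective uq i j eq)

  -- From a quasigroup back to a design

  module _ {N k} (Q : FlowQuasigroup k (↔-id (Fin N))) where
    open FlowQuasigroup Q

    private
      data Line (a b : Fin N) : Fin N → Set where
        on₁ : Line a b a
        on₂ : Line a b b
        on₃ : Line a b (a ∙ b)

      line : Fin N → Fin N → Subset N
      line a b = ⁅ a ⁆ ∪ (⁅ b ⁆ ∪ ⁅ a ∙ b ⁆)

      line⁺ : ∀ {a b x} → Line a b x → x ∈ line a b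
      line⁺ on₁ = x∈p∪q⁺ (inj₁ (x∈⁅x⁆ _))
      line⁺ on₂ = x∈p∪q⁺ (inj₂ (x∈p∪q⁺ (inj₁ (x∈⁅x⁆ _))))
      line⁺ on₃ = x∈p∪q⁺ (inj₂ (x∈p∪q⁺ (inj₂ (x∈⁅x⁆ _))))

      line⁻ : ∀ {a b x} → x ∈ line a b → Line a b x
      line⁻ {a} {b} x∈ with x∈p∪q⁻ ⁅ a ⁆ _ x∈
      ... | inj₁ x∈a with refl ← x∈⁅y⁆⇒x≡y a x∈a = on₁
      ... | inj₂ x∈bc with ∈-pair⁻ x∈bc
      ...   | inj₁ refl = on₂
      ...   | inj₂ refl = on₃

      -- Selects one of the six ordered pairs that span the same block, so that no block is listed
      -- twice.
      Sorted : Fin N × Fin N → Set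
      Sorted (a , b) = a < b × b < a ∙ b

      sorted? : Decidable Sorted
      sorted? (a , b) = (a <? b) ×-dec (b <? a ∙ b)

      lines : List (Fin N × Fin N)
      lines = filter sorted? (cartesianProduct (allFin N) (allFin N))

      lines-sorted : ∀ i → Sorted (lookup lines i)
      lines-sorted i = proj₂ (∈-filter⁻ sorted? {xs = cartesianProduct (allFin N) (allFin N)} (∈-lookup i))

      lines-complete : ∀ {q} → Sorted q → ∃ λ i → q ≡ lookup lines i
      lines-complete {q} s = index q∈ , lookup-index q∈
        where q∈ = ∈-filter⁺ sorted? (∈-cartesianProduct⁺ (∈-allFin (proj₁ q)) (∈-allFin (proj₂ q))) s

      lines-unique : Unique lines
      lines-unique = filter⁺ sorted? (cartesianProduct⁺ (allFin⁺ N) (allFin⁺ N))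

      absorb′ : ∀ a b → a ∙ b ∙ a ≡ b
      absorb′ a b = trans (comm (a ∙ b) a) (absorb a b)

      absorb″ : ∀ a b → a ∙ b ∙ b ≡ a
      absorb″ a b = trans (cong (_∙ b) (comm a b)) (absorb′ b a)

      ∙≢ˡ : ∀ {a b} → a ≢ b → a ∙ b ≢ a
      ∙≢ˡ {a} {b} a≢b eq = a≢b (trans (sym (idem a)) (trans (cong (a ∙_) (sym eq)) (absorb a b)))

      ∙≢ʳ : ∀ {a b} → a ≢ b → a ∙ b ≢ b
      ∙≢ʳ {a} {b} a≢b eq = ∙≢ˡ (a≢b ∘ sym) (trans (comm b a) eq)

      Line-∙ : ∀ {a b x y} → Line a b x → Line a b y → Line a b (x ∙ y)
      Line-∙ {a} {b} on₁ on₁ = subst (Line a b) (sym (idem _)) on₁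
      Line-∙ {a} {b} on₁ on₂ = on₃
      Line-∙ {a} {b} on₁ on₃ = subst (Line a b) (sym (absorb a b)) on₂
      Line-∙ {a} {b} on₂ on₁ = subst (Line a b) (comm a b) on₃
      Line-∙ {a} {b} on₂ on₂ = subst (Line a b) (sym (idem _)) on₂
      Line-∙ {a} {b} on₂ on₃ = subst (Line a b) (sym (trans (comm b _) (absorb″ a b))) on₁
      Line-∙ {a} {b} on₃ on₁ = subst (Line a b) (sym (absorb′ a b)) on₂
      Line-∙ {a} {b} on₃ on₂ = subst (Line a b) (sym (absorb″ a b)) on₁
      Line-∙ {a} {b} on₃ on₃ = subst (Line a b) (sym (idem _)) on₃

      w-line : ∀ {a b x y} → Line a b x → Line a b y → x ≢ y → w x y ≡ w a b
      w-line on₁ on₁ x≢y = ⊥-elim (x≢y refl)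
      w-line on₁ on₂ x≢y = refl
      w-line on₁ on₃ x≢y = w-third _ _
      w-line on₂ on₁ x≢y = w-sym _ _
      w-line on₂ on₂ x≢y = ⊥-elim (x≢y refl)
      w-line {a} {b} on₂ on₃ x≢y = trans (cong (w b) (comm a b)) (trans (w-third b a) (w-sym b a))
      w-line on₃ on₁ x≢y = trans (w-sym _ _) (w-third _ _)
      w-line {a} {b} on₃ on₂ x≢y = trans (w-sym _ _) (trans (cong (w b) (comm a b)) (trans (w-third b a) (w-sym b a)))
      w-line on₃ on₃ x≢y = ⊥-elim (x≢y refl)

      ∣line∣≡3 : ∀ {a b} → a ≢ b → ∣ line a b ∣ ≡ 3
      ∣line∣≡3 {a} {b} a≢b = trans
        (∣⁅x⁆∪p∣ a (λ a∈ → [ a≢b , ∙≢ˡ a≢b ∘ sym ]′ (∈-pair⁻ a∈)))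
        (cong suc (∣⁅x,y⁆∣≡2 (∙≢ʳ a≢b ∘ sym)))

      <⇒≢ : ∀ {a b : Fin N} → a < b → a ≢ b
      <⇒≢ a<b refl = <-irrefl refl a<b

      -- The pair can be read off the point set: a is its least point, and b is the least of the
      -- others.
      sorted-injective : ∀ {a b a′ b′} → Sorted (a , b) → Sorted (a′ , b′) →
                         (∀ {x} → Line a b x → Line a′ b′ x) → (∀ {x} → Line a′ b′ x → Line a b x) →
                         (a , b) ≡ (a′ , b′)
      sorted-injective {a} {b} {a′} {b′} s s′ ⊆ ⊇ = ×-≡,≡→≡ (a≡a′ , b≡b′)
        where
        least : ∀ {a b x} → Sorted (a , b) → Line a b x → x ≡ a ⊎ a < x
        least s on₁ = inj₁ refl
        least (a<b , _) on₂ = inj₂ a<b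
        least (a<b , b<c) on₃ = inj₂ (<-trans a<b b<c)
        second : ∀ {a b x} → Sorted (a , b) → Line a b x → a < x → x ≡ b ⊎ b < x
        second s on₁ a<a = ⊥-elim (<-irrefl refl a<a)
        second s on₂ _ = inj₁ refl
        second (_ , b<c) on₃ _ = inj₂ b<c
        antisym : ∀ {x y : Fin N} → x ≡ y ⊎ y < x → y ≡ x ⊎ x < y → x ≡ y
        antisym (inj₁ eq) _ = eq
        antisym (inj₂ _) (inj₁ eq) = sym eq
        antisym (inj₂ y<x) (inj₂ x<y) = ⊥-elim (<-asym x<y y<x)
        a≡a′ : a ≡ a′
        a≡a′ = antisym (least s′ (⊆ on₁)) (least s (⊇ on₁))
        b≡b′ : b ≡ b′
        b≡b′ = antisym (second s′ (⊆ on₂) (subst (_< b) a≡a′ (proj₁ s)))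
                       (second s (⊇ on₂) (subst (_< b′) (sym a≡a′) (proj₁ s′)))

      -- A line is recovered from any two of its points as {x , y , x ∙ y}.
      Line-⊆ : ∀ {a b a′ b′ x y} → a ≢ b → x ≢ y → Line a b x → Line a b y →
               Line a′ b′ x → Line a′ b′ y → ∀ {z} → Line a b z → Line a′ b′ z
      Line-⊆ {a} {b} {x = x} {y} a≢b x≢y x∈ y∈ x∈′ y∈′ {z} z∈ with z ≟ x | z ≟ y
      ... | yes refl | _ = x∈′
      ... | no _ | yes refl = y∈′
      ... | no z≢x | no z≢y with third (line a b) (∣line∣≡3 a≢b) (line⁺ x∈) (line⁺ y∈) x≢y
      ...   | _ , _ , _ , _ , unique with refl ← trans (unique (line⁺ z∈) z≢x z≢y)
                                                  (sym (unique (line⁺ (Line-∙ x∈ y∈)) (∙≢ˡ x≢y) (∙≢ʳ x≢y))) = Line-∙ x∈′ y∈′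

      Line-unique : ∀ {a b a′ b′ x y} → Sorted (a , b) → Sorted (a′ , b′) → x ≢ y →
                    Line a b x → Line a b y → Line a′ b′ x → Line a′ b′ y → (a , b) ≡ (a′ , b′)
      Line-unique s s′ x≢y x∈ y∈ x∈′ y∈′ = sorted-injective s s′
        (Line-⊆ (<⇒≢ (proj₁ s)) x≢y x∈ y∈ x∈′ y∈′) (Line-⊆ (<⇒≢ (proj₁ s′)) x≢y x∈′ y∈′ x∈ y∈)

      -- The point `x ∙ y` lies below x, between x and y, or above y; in each case the two smallest
      -- of the three points form the sorted pair.
      ∃sorted-< : ∀ {x y} → x < y → ∃₂ λ a b → Sorted (a , b) × Line a b x × Line a b y
      ∃sorted-< {x} {y} x<y with <-cmp (x ∙ y) x | <-cmp (x ∙ y) y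
      ... | tri≈ _ eq _  | _            = ⊥-elim (∙≢ˡ (<⇒≢ x<y) eq)
      ... | _            | tri≈ _ eq _  = ⊥-elim (∙≢ʳ (<⇒≢ x<y) eq)
      ... | tri< z<x _ _ | _            = x ∙ y , x ,
        (z<x , subst (x <_) (sym (absorb′ x y)) x<y) , on₂ , subst (Line _ _) (absorb′ x y) on₃
      ... | tri> _ _ x<z | tri< z<y _ _ = x , x ∙ y ,
        (x<z , subst (x ∙ y <_) (sym (absorb x y)) z<y) , on₁ , subst (Line _ _) (absorb x y) on₃
      ... | tri> _ _ _   | tri> _ _ y<z = x , y , (x<y , y<z) , on₁ , on₂

      ∃sorted : ∀ {x y} → x ≢ y → ∃₂ λ a b → Sorted (a , b) × Line a b x × Line a b y
      ∃sorted {x} {y} x≢y with <-cmp x y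
      ... | tri≈ _ x≡y _ = ⊥-elim (x≢y x≡y)
      ... | tri< x<y _ _ = ∃sorted-< x<y
      ... | tri> _ _ y<x with ∃sorted-< y<x
      ...   | a , b , s , y∈ , x∈ = a , b , s , x∈ , y∈

    design : STS N
    design = record
      { #blocks = length lines
      ; block = λ i → uncurry line (lookup lines i)
      ; block-injective = λ {i} {j} eq → lookup-injective lines-unique i j
          (sorted-injective (lines-sorted i) (lines-sorted j)
            (λ x∈ → line⁻ (subst (_ ∈_) eq (line⁺ x∈))) (λ x∈ → line⁻ (subst (_ ∈_) (sym eq) (line⁺ x∈))))
      ; block-size = λ i → ∣line∣≡3 (<⇒≢ (proj₁ (lines-sorted i)))
      ; pair-covered = covered }
      where
      covered : ∀ p → ∣ p ∣ ≡ 2 → ∃! _≡_ (λ i → p ⊆ uncurry line (lookup lines i))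
      covered p ∣p∣≡2 with ∣p∣≡suc⇒∃ p ∣p∣≡2
      ... | x , x∈p , ∣p-x∣≡1 with ∣p∣≡suc⇒∃ (p - x) ∣p-x∣≡1
      ...   | y , y∈p-x , ∣∣≡0 with ∈-remove⁻ p y∈p-x
      ...     | y∈p , y≢x with ∃sorted (y≢x ∘ sym)
      ...       | a , b , s , x∈ , y∈ with lines-complete s
      ...         | i , eq = i
        , (λ {z} z∈p → subst (λ q → z ∈ uncurry line q) eq (line⁺ (p⊆ z∈p)))
        , (λ {j} p⊆j → lookup-injective lines-unique i j (trans (sym eq)
             (Line-unique s (lines-sorted j) (y≢x ∘ sym) x∈ y∈ (line⁻ (p⊆j x∈p)) (line⁻ (p⊆j y∈p)))))
        where
        p⊆ : ∀ {z} → z ∈ p → Line a b z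
        p⊆ {z} z∈p with z ≟ x | z ≟ y
        ... | yes refl | _ = x∈
        ... | no _ | yes refl = y∈
        ... | no z≢x | no z≢y = ⊥-elim (∣p∣≡0⇒∉ ∣∣≡0 z (x∈p∧x≢y⇒x∈p-y (x∈p∧x≢y⇒x∈p-y z∈p z≢x) z≢y))

    design-flow : ZeroSumFlow design k
    design-flow = record
      { flow = λ i → uncurry w (lookup lines i)
      ; flow-range = λ i → w-range (<⇒≢ (proj₁ (lines-sorted i)))
      -- By `sum-pairs` the row sum in `w-sum` is twice the sum over the blocks through x, and the
      -- factor 2 cancels.
      ; zero-sum = λ x → ℤₚ.*-cancelˡ-≡ (ℤ.+ 2) _ 0ℤ (trans
          (sym (Cover.sum-pairs design (λ i → uncurry w (lookup lines i)) w w-diag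
            (λ i x∈ y∈ x≢y → w-line (line⁻ x∈) (line⁻ y∈) x≢y) x))
          (w-sum x)) }

-- The finite pattern of blocks on quarters and small differences

module Pattern where

  open Summation
  open import Data.Bool as Bool using (Bool; not; if_then_else_; _∧_)
  open import Data.Fin using (Fin; _<?_)
  open import Data.Fin.Patterns
  open import Data.Fin.Properties using (_≟_; all?)
  open import Data.Integer as ℤ using (ℤ; 0ℤ; 1ℤ; -1ℤ; _+_; _*_; -_)
  open import Data.List using (List; []; _∷_; concatMap)
  open import Data.Nat as ℕ using (ℕ)
  open import Data.Product using (_×_; _,_; proj₁; proj₂)
  open import Data.Product.Properties using (≡-dec)
  open import Data.Sum using (_⊎_)
  open import Relation.Binary.PropositionalEquality
  open import Relation.Nullary using (Dec; does; yes; no; _×-dec_; _⊎-dec_)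
  open import Relation.Nullary.Decidable using (from-yes)

  Quarter Shift Class : Set
  Quarter = Fin 4
  Shift   = Fin 3
  Class   = Fin 3

  -- The differences −1, 0, 1 in ℤ/m.
  pattern ↓ = 0F
  pattern ○ = 1F
  pattern ↑ = 2F

  pattern α = 0F
  pattern β = 1F
  pattern γ = 2F

  neg : Shift → Shift
  neg ↓ = ↑
  neg ○ = ○
  neg ↑ = ↓

  -- The difference e − s; junk for {e , s} = {↑ , ↓}, where it would be ±2.
  sub : Shift → Shift → Shift
  sub ○ s = neg s
  sub e ○ = e
  sub _ _ = ○

  -- Exactly the pairs that avoid the junk in `sub`.
  Compatible : Shift → Shift → Set
  Compatible e s = e ≡ s ⊎ e ≡ ○ ⊎ s ≡ ○

  -- The parity of m = 3 + M.
  data Parity : Set where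
    odd even : Parity

  -- The block through (h , x) and (k , x + s): a triangle with third corner
  -- (l , x + e), or the edge joined to a reflection or to one of the two
  -- translation factors whose difference is ±1.
  data Entry : Set where
    third   : Quarter → Shift → Entry
    reflect : Entry
    extra   : Fin 2 → Entry

  -- The same for a difference other than −1, 0, 1.  Translation factors are
  -- indexed by the difference taken upwards; the Boolean says whether h < k.
  data Far : Set where
    same  : Far
    apart : Class → Bool → Far

  swap : Shift → Entry → Entry
  swap s (third l e) = third l (sub e s)
  swap s reflect     = reflect
  swap s (extra i)   = extra i

  flip : Far → Far
  flip same        = same
  flip (apart c d) = apart c (not d)

  -- Addition of a nonzero element of (ℤ/2)²; the three classes are the three ways to split the
  -- quarters into two pairs.
  act : Class → Quarter → Quarter
  act α 0F = 1F
  act α 1F = 0F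
  act α 2F = 3F
  act α 3F = 2F
  act β 0F = 2F
  act β 1F = 3F
  act β 2F = 0F
  act β 3F = 1F
  act γ 0F = 3F
  act γ 1F = 2F
  act γ 2F = 1F
  act γ 3F = 0F

  -- The nontrivial character of (ℤ/2)² with kernel {0, c}.
  χ : Class → Quarter → ℤ
  χ c h = if does (h ≟ 0F) then 1ℤ else if does (h ≟ act c 0F) then 1ℤ else -1ℤ

  rising : Class → Quarter → Bool
  rising c h = does (h <? act c h)

  far : Quarter → Quarter → Far
  far h k =
    if does (act α h ≟ k) then apart α (rising α h) else
    if does (act β h ≟ k) then apart β (rising β h) else
    if does (act γ h ≟ k) then apart γ (rising γ h) else same

  Corner : Set
  Corner = Quarter × Shift

  _≟ᶜ_ : (P R : Corner) → Dec (P ≡ R)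
  _≟ᶜ_ = ≡-dec _≟_ _≟_

  Triangle : Set
  Triangle = Corner × Corner × Corner

  orders : Triangle → List Triangle
  orders (P , R , T) =
    (P , R , T) ∷ (P , T , R) ∷ (R , P , T) ∷ (R , T , P) ∷ (T , P , R) ∷ (T , R , P) ∷ []

  -- One triangle from each translation class.  Between quarters the differences
  -- left to the translation factors must be the same for both pairs of quarters
  -- in a class α, β, γ, up to the direction in which they are taken.
  triangles : Parity → List Triangle
  triangles odd  = ((1F , ○) , (2F , ○) , (3F , ↑)) ∷ ((0F , ○) , (2F , ↑) , (3F , ○)) ∷
                   ((0F , ○) , (0F , ↑) , (2F , ○)) ∷ ((1F , ○) , (1F , ↑) , (3F , ○)) ∷ []
  triangles even = ((1F , ○) , (2F , ○) , (3F , ↑)) ∷ ((0F , ○) , (2F , ↑) , (3F , ○)) ∷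
                   ((0F , ↑) , (1F , ○) , (3F , ○)) ∷ ((0F , ○) , (1F , ↑) , (2F , ○)) ∷ []

  -- The edges with difference -1, 0 or 1 that are left to the reflections. For odd m the triangles
  -- use up the differences ±1 inside quarters 0 and 1, so at these differences the reflections join
  -- the two quarters instead.
  mate : Parity → Quarter → Shift → Quarter
  mate _    h  ○ = act α h
  mate odd  0F _ = 1F
  mate odd  1F _ = 0F
  mate _    h  _ = h

  -- The triangles leave both differences ±1 in class γ when m is odd, and one of them in each of β
  -- and γ when m is even.
  extraClass : Parity → Fin 2 → Class
  extraClass odd  _  = γ
  extraClass even 0F = β
  extraClass even 1F = γ

  extraSign : Parity → Fin 2 → ℤ
  extraSign odd 0F = 1ℤ
  extraSign _   _  = -1ℤ

  -- The shift is reversed at the upper quarter of a pair, so that the edge is the same seen from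
  -- either end.
  extraShift : Parity → Fin 2 → Quarter → Shift
  extraShift p i h = if rising (extraClass p i) h then s p i else neg (s p i)
    where
    s : Parity → Fin 2 → Shift
    s odd  0F = ↑
    s odd  1F = ↓
    s even 0F = ↓
    s even 1F = ↑

  extraCorner : Parity → Fin 2 → Quarter → Corner
  extraCorner p i h = act (extraClass p i) h , extraShift p i h

  -- Triangles are compared up to translation, by their differences from the first corner. All
  -- corners in `triangles` have shift 0 or 1, so `sub` gives true differences here.
  search : List Triangle → Quarter → Corner → Entry → Entry
  search [] h R t = t
  search (((h′ , a) , (k , b) , (l , c)) ∷ ts) h R t =
    if does (h′ ≟ h) ∧ does ((k , sub b a) ≟ᶜ R) then third l (sub c a) else search ts h R t

  table : Parity → Quarter → Quarter → Shift → Entry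
  table p h k s =
    if does ((k , s) ≟ᶜ (h , ○)) then third h ○ else
    search (concatMap orders (triangles p)) h (k , s)
      -- Whatever remains is declared a reflection; `table-sound` confirms that it is one.
      (if does (extraCorner p 0F h ≟ᶜ (k , s)) then extra 0F else
       if does (extraCorner p 1F h ≟ᶜ (k , s)) then extra 1F else reflect)

  -- The value of a triangle; zero only on the degenerate triangle (P , P , P),
  -- as no triangle lies within one quarter.
  ω : Quarter → Quarter → Quarter → ℤ
  ω h k l = if does (h ≟ k) ∧ does (h ≟ l) then 0ℤ else χ α h * χ α k * χ α l

  thirdWeight : Quarter → Quarter → Entry → ℤ
  thirdWeight h k (third l _) = ω h k l
  thirdWeight h k _           = 0ℤ

  -- The local form of absorption: the third corner taken twice returns the original corner, and a
  -- factor leads from the first end of its edge to the second. A triangle entry also has a value ±1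
  -- unless its two points coincide.
  Sound : Parity → Quarter → Quarter → Shift → Entry → Set
  Sound p h k s (third l e) = table p h l e ≡ third k s × Compatible e s ×
                              ((k , s) ≡ (h , ○) ⊎ ℤ.∣ ω h k l ∣ ≡ 1)
  Sound p h k s reflect     = mate p h s ≡ k
  Sound p h k s (extra i)   = extraCorner p i h ≡ (k , s)

  SoundFar : Quarter → Quarter → Far → Set
  SoundFar h k same        = h ≡ k
  SoundFar h k (apart c d) = act c h ≡ k × rising c h ≡ d

  infix 4 _≟ᵉ_ _≟ᵇ_ _≟ᶠ_

  _≟ᵉ_ : (s t : Entry) → Dec (s ≡ t)
  third l e ≟ᵉ third l′ e′ with (l , e) ≟ᶜ (l′ , e′)
  ... | yes refl = yes refl
  ... | no  ≢    = no λ { refl → ≢ refl }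
  third _ _ ≟ᵉ reflect     = no λ ()
  third _ _ ≟ᵉ extra _     = no λ ()
  reflect   ≟ᵉ third _ _   = no λ ()
  reflect   ≟ᵉ reflect     = yes refl
  reflect   ≟ᵉ extra _     = no λ ()
  extra _   ≟ᵉ third _ _   = no λ ()
  extra _   ≟ᵉ reflect     = no λ ()
  extra i   ≟ᵉ extra j     with i ≟ j
  ... | yes refl = yes refl
  ... | no  ≢    = no λ { refl → ≢ refl }

  _≟ᵇ_ : (a b : Bool) → Dec (a ≡ b)
  _≟ᵇ_ = Bool._≟_

  _≟ᶠ_ : (s t : Far) → Dec (s ≡ t)
  same      ≟ᶠ same        = yes refl
  same      ≟ᶠ apart _ _   = no λ ()
  apart _ _ ≟ᶠ same        = no λ ()
  apart c d ≟ᶠ apart c′ d′ with c ≟ c′ | d ≟ᵇ d′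
  ... | yes refl | yes refl = yes refl
  ... | no ≢     | _        = no λ { refl → ≢ refl }
  ... | _        | no ≢     = no λ { refl → ≢ refl }

  sound? : ∀ p h k s t → Dec (Sound p h k s t)
  sound? p h k s (third l e) = table p h l e ≟ᵉ third k s ×-dec
    (e ≟ s ⊎-dec e ≟ ○ ⊎-dec s ≟ ○) ×-dec ((k , s) ≟ᶜ (h , ○) ⊎-dec ℤ.∣ ω h k l ∣ ℕ.≟ 1)
  sound? p h k s reflect     = mate p h s ≟ k
  sound? p h k s (extra i)   = extraCorner p i h ≟ᶜ (k , s)

  soundFar? : ∀ h k t → Dec (SoundFar h k t)
  soundFar? h k same        = h ≟ k
  soundFar? h k (apart c d) = act c h ≟ k ×-dec rising c h ≟ᵇ d

  -- Exhaustive checks of the tables and signs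

  table-sound : ∀ p h k s → Sound p h k s (table p h k s)
  table-sound odd  = from-yes (all? λ h → all? λ k → all? λ s → sound? odd h k s (table odd h k s))
  table-sound even = from-yes (all? λ h → all? λ k → all? λ s → sound? even h k s (table even h k s))

  -- Behind commutativity: `search` runs through all six orders of a triangle, and the factor of an
  -- edge does not depend on its direction.
  table-swap : ∀ p h k s → table p k h (neg s) ≡ swap s (table p h k s)
  table-swap odd  = from-yes (all? λ h → all? λ k → all? λ s →
    table odd k h (neg s) ≟ᵉ swap s (table odd h k s))
  table-swap even = from-yes (all? λ h → all? λ k → all? λ s →
    table even k h (neg s) ≟ᵉ swap s (table even h k s))

  table-diag : ∀ p h → table p h h ○ ≡ third h ○
  table-diag odd  = from-yes (all? λ h → table odd h h ○ ≟ᵉ third h ○)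
  table-diag even = from-yes (all? λ h → table even h h ○ ≟ᵉ third h ○)

  table-mate : ∀ p h s → table p h (mate p h s) s ≡ reflect
  table-mate odd  = from-yes (all? λ h → all? λ s → table odd h (mate odd h s) s ≟ᵉ reflect)
  table-mate even = from-yes (all? λ h → all? λ s → table even h (mate even h s) s ≟ᵉ reflect)

  table-extra : ∀ p i h → table p h (proj₁ (extraCorner p i h)) (proj₂ (extraCorner p i h)) ≡ extra i
  table-extra odd  = from-yes (all? λ i → all? λ h →
    table odd h (proj₁ (extraCorner odd i h)) (proj₂ (extraCorner odd i h)) ≟ᵉ extra i)
  table-extra even = from-yes (all? λ i → all? λ h →
    table even h (proj₁ (extraCorner even i h)) (proj₂ (extraCorner even i h)) ≟ᵉ extra i)

  -- Each triangle is met once at each of its two other corners, whence the factor 2. Triangles with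
  -- two corners in quarters 2 and 3 have value 1, those with one have value -1. A point of quarter
  -- 0 or 1 lies on one of the former and two of the latter, and a point of quarter 2 or 3 the other
  -- way round.
  table-weight : ∀ p h → sum (λ k → sum (λ s → thirdWeight h k (table p h k s))) ≡ ℤ.- χ α h + ℤ.- χ α h
  table-weight odd  = from-yes (all? λ h →
    sum (λ k → sum (λ s → thirdWeight h k (table odd h k s))) ℤ.≟ ℤ.- χ α h + ℤ.- χ α h)
  table-weight even = from-yes (all? λ h →
    sum (λ k → sum (λ s → thirdWeight h k (table even h k s))) ℤ.≟ ℤ.- χ α h + ℤ.- χ α h)

  far-sound : ∀ h k → SoundFar h k (far h k)
  far-sound = from-yes (all? λ h → all? λ k → soundFar? h k (far h k))

  far-flip : ∀ h k → far k h ≡ flip (far h k)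
  far-flip = from-yes (all? λ h → all? λ k → far k h ≟ᶠ flip (far h k))

  far-diag : ∀ h → far h h ≡ same
  far-diag = from-yes (all? λ h → far h h ≟ᶠ same)

  far-act : ∀ c h → far h (act c h) ≡ apart c (rising c h)
  far-act = from-yes (all? λ c → all? λ h → far h (act c h) ≟ᶠ apart c (rising c h))

  χ-act : ∀ c h → χ c (act c h) ≡ χ c h
  χ-act = from-yes (all? λ c → all? λ h → χ c (act c h) ℤ.≟ χ c h)

  χ-mate : ∀ p h s → χ α (mate p h s) ≡ χ α h
  χ-mate odd  = from-yes (all? λ h → all? λ s → χ α (mate odd h s) ℤ.≟ χ α h)
  χ-mate even = from-yes (all? λ h → all? λ s → χ α (mate even h s) ℤ.≟ χ α h)

  ∣χ∣≡1 : ∀ c h → ℤ.∣ χ c h ∣ ≡ 1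
  ∣χ∣≡1 = from-yes (all? λ c → all? λ h → ℤ.∣ χ c h ∣ ℕ.≟ 1)

  sum-χ : ∀ c → sum (χ c) ≡ 0ℤ
  sum-χ = from-yes (all? λ c → sum (χ c) ℤ.≟ 0ℤ)

  ∣extraSign∣≡1 : ∀ p i → ℤ.∣ extraSign p i ∣ ≡ 1
  ∣extraSign∣≡1 odd  0F = refl
  ∣extraSign∣≡1 odd  1F = refl
  ∣extraSign∣≡1 even _  = refl

  ω-comm : ∀ h k l → ω k h l ≡ ω h k l
  ω-comm = from-yes (all? λ h → all? λ k → all? λ l → ω k h l ℤ.≟ ω h k l)

  ω-swap : ∀ h k l → ω h l k ≡ ω h k l
  ω-swap = from-yes (all? λ h → all? λ k → all? λ l → ω h l k ℤ.≟ ω h k l)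

  ω-diag : ∀ h → ω h h h ≡ 0ℤ
  ω-diag = from-yes (all? λ h → ω h h h ℤ.≟ 0ℤ)

  -- The alternating sum 1 − 1 + 1 − ⋯ with M = m − 3 terms.
  surplus : Parity → ℤ
  surplus odd  = 0ℤ
  surplus even = 1ℤ

  signTotal : Parity → Quarter → ℤ
  signTotal p h = (1ℤ + - surplus p) * χ α h +
    (sum (λ c → surplus p * χ c h) + sum (λ i → extraSign p i * χ (extraClass p i) h))

  -- For odd m the reflections leave one χ α, and the two extra factors cancel. For even m the
  -- reflections cancel, the other translations leave χ α + χ β + χ γ, and the extra factors remove
  -- χ β + χ γ.
  sign-total : ∀ p h → signTotal p h ≡ χ α h
  sign-total odd  = from-yes (all? λ h → signTotal odd h ℤ.≟ χ α h)
  sign-total even = from-yes (all? λ h → signTotal even h ℤ.≟ χ α h)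

-- The new blocks and their signs

module Doubling where

  open Summation
  open Pattern
  open import Algebra.Bundles using (AbelianGroup)
  open import Algebra.Structures using (IsAbelianGroup)
  import Algebra.Properties.AbelianGroup as GroupProperties
  open import Data.Bool using (Bool; true; false; if_then_else_)
  open import Data.Fin using (Fin; zero; suc)
  open import Data.Fin.Patterns
  open import Data.Fin.Properties using (_≟_)
  open import Data.Integer as ℤ using (ℤ; 0ℤ; 1ℤ; _+_; _*_; -_)
  import Data.Integer.Properties as ℤₚ
  open import Data.Nat as ℕ using (ℕ; zero; suc)
  open import Data.Product using (_×_; _,_; proj₁; proj₂)
  open import Data.Product.Properties using (≡-dec)
  open import Data.Sum using (_⊎_; inj₁; inj₂; [_,_]′)
  open import Data.Sum.Properties using (inj₁-injective; inj₂-injective)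
  open import Function using (_∘_; _↔_; mk↔ₛ′)
  open import Function.Construct.Identity using (↔-id)
  open import Function.Construct.Symmetry using (↔-sym)
  open import Relation.Binary.PropositionalEquality
  open import Relation.Nullary using (Dec; does; contradiction)
  open import Relation.Nullary.Decidable using (dec-true; dec-false)

  alt : ∀ {n} → Fin n → ℤ
  alt zero    = 1ℤ
  alt (suc i) = - alt i

  ∣alt∣≡1 : ∀ {n} (i : Fin n) → ℤ.∣ alt i ∣ ≡ 1
  ∣alt∣≡1 zero    = refl
  ∣alt∣≡1 (suc i) = trans (ℤₚ.∣-i∣≡∣i∣ (alt i)) (∣alt∣≡1 i)

  ∣*∣≡1 : ∀ {x y} → ℤ.∣ x ∣ ≡ 1 → ℤ.∣ y ∣ ≡ 1 → ℤ.∣ x * y ∣ ≡ 1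
  ∣*∣≡1 {x} {y} p q = trans (ℤₚ.∣i*j∣≡∣i∣*∣j∣ x y) (cong₂ ℕ._*_ p q)

  -- What the construction uses of ℤ/m: the group laws, and a splitting of the elements into -1, 0,
  -- 1 and M others.
  record PointGroup (M m : ℕ) : Set where
    infixl 6 _⊕_ _⊖_
    field
      _⊕_            : Fin m → Fin m → Fin m
      𝟘              : Fin m
      ⊝_             : Fin m → Fin m
      isAbelianGroup : IsAbelianGroup _≡_ _⊕_ 𝟘 ⊝_
      classes        : (Shift ⊎ Fin M) ↔ Fin m
      class-○        : to classes (inj₁ ○) ≡ 𝟘
      class-neg      : ∀ s → to classes (inj₁ (neg s)) ≡ ⊝ to classes (inj₁ s)

    _⊖_ : Fin m → Fin m → Fin m
    x ⊖ y = x ⊕ (⊝ y)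

    abelianGroup : AbelianGroup _ _
    abelianGroup = record { isAbelianGroup = isAbelianGroup }

  module Construction {M m : ℕ} (𝔾 : PointGroup M m) (p : Parity)
    (surplus-O : sum {M} alt ≡ surplus p) (surplus-G : sum {m} alt ≡ 1ℤ + - surplus p) where

    open PointGroup 𝔾
    open IsAbelianGroup isAbelianGroup using (assoc; identityˡ; identityʳ; inverseʳ) renaming (comm to ⊕-comm)
    open GroupProperties abelianGroup using (⁻¹-anti-homo-//; ⁻¹-involutive; xyx⁻¹≈y)

    G O : Set
    G = Fin m
    O = Fin M

    emb : Shift ⊎ O → G
    emb = to classes

    cl : G → Shift ⊎ O
    cl = from classes

    cl-emb : ∀ c → cl (emb c) ≡ c
    cl-emb = strictlyInverseʳ classes

    emb-cl : ∀ d → emb (cl d) ≡ d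
    emb-cl = strictlyInverseˡ classes

    ⟦_⟧ : Shift → G
    ⟦ s ⟧ = emb (inj₁ s)

    x⊕y⊖x : ∀ x y → x ⊕ y ⊖ x ≡ y
    x⊕y⊖x = xyx⁻¹≈y

    x⊕[y⊖x] : ∀ x y → x ⊕ (y ⊖ x) ≡ y
    x⊕[y⊖x] x y = trans (sym (assoc x y (⊝ x))) (x⊕y⊖x x y)

    shift-sub : ∀ {e s} → Compatible e s → ⟦ s ⟧ ⊕ ⟦ sub e s ⟧ ≡ ⟦ e ⟧
    shift-sub {e} {s} (inj₁ refl) = trans (cong (⟦ s ⟧ ⊕_) (trans (cong ⟦_⟧ (sub-self s)) class-○)) (identityʳ _)
      where
      sub-self : ∀ s → sub s s ≡ ○
      sub-self ↓ = refl
      sub-self ○ = refl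
      sub-self ↑ = refl
    shift-sub {e} {s} (inj₂ (inj₁ refl)) = trans (cong (⟦ s ⟧ ⊕_) (class-neg s)) (trans (inverseʳ _) (sym class-○))
    shift-sub {e} {s} (inj₂ (inj₂ refl)) = trans (cong₂ (λ a b → a ⊕ ⟦ b ⟧) class-○ (sub-○ e)) (identityˡ _)
      where
      sub-○ : ∀ e → sub e ○ ≡ e
      sub-○ ↓ = refl
      sub-○ ○ = refl
      sub-○ ↑ = refl

    -- The default `o` is never reached: the small differences are closed under negation, so
    -- `emb-negFar` excludes that case.
    negFar : O → O
    negFar o = [ (λ _ → o) , (λ o′ → o′) ]′ (cl (⊝ emb (inj₂ o)))

    emb-negFar : ∀ o → emb (inj₂ (negFar o)) ≡ ⊝ emb (inj₂ o)
    emb-negFar o with cl (⊝ emb (inj₂ o)) in eq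
    ... | inj₂ o′ = trans (cong emb (sym eq)) (emb-cl _)
    ... | inj₁ s  = contradiction
      (trans (sym (cl-emb (inj₂ o))) (trans (cong cl emb-o≡⟦-s⟧) (cl-emb (inj₁ (neg s))))) λ ()
      where
      emb-o≡⟦-s⟧ : emb (inj₂ o) ≡ ⟦ neg s ⟧
      emb-o≡⟦-s⟧ = trans (sym (⁻¹-involutive _))
        (trans (cong ⊝_ (trans (sym (emb-cl _)) (cong emb eq))) (sym (class-neg s)))

    negFar-involutive : ∀ o → negFar (negFar o) ≡ o
    negFar-involutive o = inj₂-injective (trans (sym (cl-emb _)) (trans (cong cl
      (trans (emb-negFar (negFar o)) (trans (cong ⊝_ (emb-negFar o)) (⁻¹-involutive _)))) (cl-emb _)))

    negClass : Shift ⊎ O → Shift ⊎ O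
    negClass = [ inj₁ ∘ neg , inj₂ ∘ negFar ]′

    emb-negClass : ∀ c → emb (negClass c) ≡ ⊝ emb c
    emb-negClass (inj₁ s) = class-neg s
    emb-negClass (inj₂ o) = emb-negFar o

    -- One-factors and third points

    Point Factor : Set
    Point = Quarter × G
    Factor = G ⊎ (Class × O) ⊎ Fin 2

    pattern reflection c    = inj₁ c
    pattern translation c o = inj₂ (inj₁ (c , o))
    pattern special i       = inj₂ (inj₂ i)

    near : G → G → Entry → Factor ⊎ Point
    near x y (third l e) = inj₂ (l , x ⊕ ⟦ e ⟧)
    near x y reflect     = inj₁ (reflection (x ⊕ y))
    near x y (extra i)   = inj₁ (special i)

    distant : G → G → O → Far → Factor ⊎ Point
    distant x y o same            = inj₁ (reflection (x ⊕ y))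
    distant x y o (apart c true)  = inj₁ (translation c o)
    distant x y o (apart c false) = inj₁ (translation c (negFar o))

    joinAt : Point → Point → Shift ⊎ O → Factor ⊎ Point
    joinAt (h , x) (k , y) (inj₁ s) = near x y (table p h k s)
    joinAt (h , x) (k , y) (inj₂ o) = distant x y o (far h k)

    join : Point → Point → Factor ⊎ Point
    join Point₁@(h , x) Point₂@(k , y) = joinAt Point₁ Point₂ (cl (y ⊖ x))

    mateOf : Quarter → Shift ⊎ O → Quarter
    mateOf h (inj₁ s) = mate p h s
    mateOf h (inj₂ o) = h

    step : Bool → O → G
    step true  o = emb (inj₂ o)
    step false o = ⊝ emb (inj₂ o)

    -- The other end of the factor's edge at a point. For a reflection the difference of the ends is
    -- (c - x) - x, and it decides the change of quarter.
    partner : Factor → Point → Point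
    partner (reflection c)    (h , x) = mateOf h (cl (c ⊖ x ⊖ x)) , c ⊖ x
    partner (translation c o) (h , x) = act c h , x ⊕ step (rising c h) o
    partner (special i)       (h , x) = proj₁ (extraCorner p i h) , x ⊕ ⟦ proj₂ (extraCorner p i h) ⟧

    join-at : ∀ {h x k y} c → y ≡ x ⊕ emb c → join (h , x) (k , y) ≡ joinAt (h , x) (k , y) c
    join-at {h} {x} {k} c refl = cong (joinAt (h , x) (k , _)) (trans (cong cl (x⊕y⊖x x (emb c))) (cl-emb c))

    -- A corner at x + e lies at difference e - s from y = x + s, a true difference by `Compatible`.
    -- Reflections are named by the symmetric sum x + y, and translations by the upward difference.
    joinAt-sym : ∀ h x k y c → y ≡ x ⊕ emb c → joinAt (k , y) (h , x) (negClass c) ≡ joinAt (h , x) (k , y) c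
    joinAt-sym h x k y (inj₁ s) refl rewrite table-swap p h k s with table p h k s | table-sound p h k s
    ... | third l e | _ , e-s , _ = cong (λ z → inj₂ (l , z)) (trans (assoc _ _ _) (cong (x ⊕_) (shift-sub e-s)))
    ... | reflect   | _ = cong (inj₁ ∘ reflection) (⊕-comm _ _)
    ... | extra i   | _ = refl
    joinAt-sym h x k y (inj₂ o) refl rewrite far-flip h k with far h k
    ... | same          = cong (inj₁ ∘ reflection) (⊕-comm _ _)
    ... | apart c true  = cong (inj₁ ∘ translation c) (negFar-involutive o)
    ... | apart c false = refl

    y≡x⊕cl : ∀ x y → y ≡ x ⊕ emb (cl (y ⊖ x))
    y≡x⊕cl x y = sym (trans (cong (x ⊕_) (emb-cl (y ⊖ x))) (x⊕[y⊖x] x y))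

    join-comm : ∀ P R → join P R ≡ join R P
    join-comm P@(h , x) R@(k , y) = sym (trans (join-at (negClass c) x≡) (joinAt-sym h x k y c (y≡x⊕cl x y)))
      where
      c = cl (y ⊖ x)
      x≡ : x ≡ y ⊕ emb (negClass c)
      x≡ = sym (trans
        (cong (y ⊕_) (trans (emb-negClass c) (trans (cong ⊝_ (emb-cl _)) (⁻¹-anti-homo-// y x)))) (x⊕[y⊖x] y x))

    join-diag : ∀ P → join P P ≡ inj₂ P
    join-diag (h , x) = trans (join-at (inj₁ ○) (sym x⊕○))
      (trans (cong (near x x) (table-diag p h)) (cong (λ z → inj₂ (h , z)) x⊕○))
      where
      x⊕○ : x ⊕ ⟦ ○ ⟧ ≡ x
      x⊕○ = trans (cong (x ⊕_) class-○) (identityʳ x)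

    -- The product of a new point with an arbitrary point of the extended system.
    op : Point → Factor ⊎ Point → Factor ⊎ Point
    op P (inj₁ j) = inj₂ (partner j P)
    op P (inj₂ R) = join P R

    partner-reflection : ∀ h x c → partner (reflection (x ⊕ (x ⊕ emb c))) (h , x) ≡ (mateOf h c , x ⊕ emb c)
    partner-reflection h x c = cong₂ _,_
      (cong (mateOf h) (trans (cong (λ z → cl (z ⊖ x)) (x⊕y⊖x x _)) (trans (cong cl (x⊕y⊖x x _)) (cl-emb c))))
      (x⊕y⊖x x _)

    joinAt-absorb : ∀ h x k y c → y ≡ x ⊕ emb c → op (h , x) (joinAt (h , x) (k , y) c) ≡ inj₂ (k , y)
    joinAt-absorb h x k y (inj₁ s) refl with table p h k s | table-sound p h k s
    ... | third l e | eq , _ = trans (join-at (inj₁ e) refl) (cong (near x _) eq)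
    ... | reflect   | eq = cong inj₂ (trans (partner-reflection h x (inj₁ s)) (cong (_, x ⊕ ⟦ s ⟧) eq))
    ... | extra i   | eq = cong (λ q → inj₂ (proj₁ q , x ⊕ ⟦ proj₂ q ⟧)) eq
    joinAt-absorb h x k y (inj₂ o) refl with far h k | far-sound h k
    ... | same          | eq = cong inj₂ (trans (partner-reflection h x (inj₂ o)) (cong (_, x ⊕ emb (inj₂ o)) eq))
    ... | apart c true  | eq , rise = cong₂ (λ a b → inj₂ (a , x ⊕ b)) eq (cong (λ b → step b o) rise)
    ... | apart c false | eq , rise = cong₂ (λ a b → inj₂ (a , x ⊕ b)) eq (trans (cong (λ b → step b (negFar o)) rise)
      (trans (cong ⊝_ (emb-negFar o)) (⁻¹-involutive _)))

    join-absorb : ∀ P R → op P (join P R) ≡ inj₂ R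
    join-absorb (h , x) (k , y) = joinAt-absorb h x k y _ (y≡x⊕cl x y)

    -- With `join-absorb`, this shows that P and R are joined by an edge of factor j exactly when R
    -- is `partner j P`.
    partner-absorb : ∀ P j → join P (partner j P) ≡ inj₁ j
    partner-absorb (h , x) (reflection c) = trans (by-class (cl (c ⊖ x ⊖ x))) (cong (inj₁ ∘ reflection) (x⊕[y⊖x] x c))
      where
      by-class : ∀ d → joinAt (h , x) (mateOf h d , c ⊖ x) d ≡ inj₁ (reflection (x ⊕ (c ⊖ x)))
      by-class (inj₁ s) = cong (near x (c ⊖ x)) (table-mate p h s)
      by-class (inj₂ o) = cong (distant x (c ⊖ x) o) (far-diag h)
    partner-absorb (h , x) (translation c o) with rising c h | far-act c h
    ... | true  | eq = trans (join-at (inj₂ o) refl) (cong (distant x _ o) eq)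
    ... | false | eq = trans (join-at (inj₂ (negFar o)) (cong (x ⊕_) (sym (emb-negFar o))))
      (trans (cong (distant x _ (negFar o)) eq) (cong (inj₁ ∘ translation c) (negFar-involutive o)))
    partner-absorb (h , x) (special i) =
      trans (join-at (inj₁ (proj₂ (extraCorner p i h))) refl) (cong (near x _) (table-extra p i h))

    -- By symmetry of `join` the edge back to P lies in factor j too, and `join-absorb` at
    -- `partner j P` recovers P.
    partner-involutive : ∀ j P → partner j (partner j P) ≡ P
    partner-involutive j P = inj₂-injective (trans
      (cong (op (partner j P)) (sym (trans (join-comm (partner j P) P) (partner-absorb P j))))
      (join-absorb (partner j P) P))

    -- Signs of the new blocks and their sums

    sgn : Factor → Quarter → ℤ
    sgn (reflection c)    h = alt c * χ α h
    sgn (translation c o) h = alt o * χ c h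
    sgn (special i)       h = extraSign p i * χ (extraClass p i) h

    -- A factor moves quarters only by elements of the kernel of its character, so both ends of an
    -- edge agree on the value of the block.
    sgn-partner : ∀ j P → sgn j (proj₁ (partner j P)) ≡ sgn j (proj₁ P)
    sgn-partner (reflection c) (h , x) = cong (alt c *_) (by-class (cl (c ⊖ x ⊖ x)))
      where
      by-class : ∀ d → χ α (mateOf h d) ≡ χ α h
      by-class (inj₁ s) = χ-mate p h s
      by-class (inj₂ o) = refl
    sgn-partner (translation c o) (h , x) = cong (alt o *_) (χ-act c h)
    sgn-partner (special i)       (h , x) = cong (extraSign p i *_) (χ-act (extraClass p i) h)

    ∣sgn∣≡1 : ∀ j h → ℤ.∣ sgn j h ∣ ≡ 1
    ∣sgn∣≡1 (reflection c)    h = ∣*∣≡1 {alt c} (∣alt∣≡1 c) (∣χ∣≡1 α h)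
    ∣sgn∣≡1 (translation c o) h = ∣*∣≡1 {alt o} (∣alt∣≡1 o) (∣χ∣≡1 c h)
    ∣sgn∣≡1 (special i)       h = ∣*∣≡1 {extraSign p i} (∣extraSign∣≡1 p i) (∣χ∣≡1 (extraClass p i) h)

    weight triangleWeight factorWeight : Quarter → Quarter → Factor ⊎ Point → ℤ
    weight h k (inj₁ j)               = sgn j h
    weight h k (inj₂ (l , _))         = ω h k l
    triangleWeight h k (inj₁ _)       = 0ℤ
    triangleWeight h k (inj₂ (l , _)) = ω h k l
    factorWeight h k (inj₁ j)         = sgn j h
    factorWeight h k (inj₂ _)         = 0ℤ

    weight-split : ∀ h k r → weight h k r ≡ triangleWeight h k r + factorWeight h k r
    weight-split h k (inj₁ j) = sym (ℤₚ.+-identityˡ _)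
    weight-split h k (inj₂ _) = sym (ℤₚ.+-identityʳ _)

    eG = ↔-id G
    eO = ↔-id O
    eQ = ↔-id Quarter
    eC = ↔-id Class
    eS = ↔-id Shift
    eE = ↔-id (Fin 2)

    points : Fin (4 ℕ.* m) ↔ Point
    points = eQ ×ᶠ eG

    factors : Fin (m ℕ.+ (3 ℕ.* M ℕ.+ 2)) ↔ Factor
    factors = eG ⊎ᶠ (eC ×ᶠ eO) ⊎ᶠ eE

    _≟ᵖ_ : (P R : Point) → Dec (P ≡ R)
    _≟ᵖ_ = ≡-dec _≟_ _≟_

    sum-alt : ∀ {n} x → sum (λ (i : Fin n) → alt i * x) ≡ sum (alt {n}) * x
    sum-alt {n} x = sym (*-distribʳ-sum x (alt {n}))

    sum-sgn : ∀ h → ∑ factors (λ j → sgn j h) ≡ χ α h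
    sum-sgn h = begin
      ∑ factors (λ j → sgn j h)
        ≡⟨ ∑-⊎ eG ((eC ×ᶠ eO) ⊎ᶠ eE) (λ j → sgn j h) ⟩
      reflections + ∑ ((eC ×ᶠ eO) ⊎ᶠ eE) (λ j → sgn (inj₂ j) h)
        ≡⟨ cong (reflections +_) (∑-⊎ (eC ×ᶠ eO) eE (λ j → sgn (inj₂ j) h)) ⟩
      reflections + (∑ (eC ×ᶠ eO) (λ q → sgn (inj₂ (inj₁ q)) h) + specials)
        ≡⟨ cong (λ z → reflections + (z + specials)) (∑-× eC eO (λ q → sgn (inj₂ (inj₁ q)) h)) ⟩
      reflections + (sum (λ c → sum (λ o → alt {M} o * χ c h)) + specials)
        ≡⟨ cong₂ (λ y z → y + (z + specials))
             (trans (sum-alt {m} (χ α h)) (cong (_* χ α h) surplus-G))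
             (sum-cong (λ c → trans (sum-alt {M} (χ c h)) (cong (_* χ c h) surplus-O))) ⟩
      (1ℤ + - surplus p) * χ α h + (sum (λ c → surplus p * χ c h) + specials)
        ≡⟨ sign-total p h ⟩
      χ α h
        ∎
      where
      open ≡-Reasoning
      reflections = sum (λ c → alt {m} c * χ α h)
      specials = sum (λ i → extraSign p i * χ (extraClass p i) h)

    -- Each factor has exactly one edge at P, so summing over the other ends amounts to summing over
    -- the factors.
    sum-factorWeight : ∀ P → ∑ points (λ R → factorWeight (proj₁ P) (proj₁ R) (join P R)) ≡ χ α (proj₁ P)
    sum-factorWeight P@(h , x) = begin
      ∑ points (λ R → factorWeight h (proj₁ R) (join P R))  ≡⟨ sum-cong (λ i → split (to points i)) ⟩
      ∑ points (λ R → ∑ factors (λ j → c j R))             ≡⟨ ∑-comm (λ r j → c (to factors j) (to points r)) ⟩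
      ∑ factors (λ j → ∑ points (c j))                     ≡⟨ sum-cong (λ i → inner (to factors i)) ⟩
      ∑ factors (λ j → sgn j h)                            ≡⟨ sum-sgn h ⟩
      χ α h                                                ∎
      where
      open ≡-Reasoning
      c : Factor → Point → ℤ
      c j R = if does (partner j P ≟ᵖ R) then sgn j h else 0ℤ

      c-yes : ∀ j {R} → partner j P ≡ R → c j R ≡ sgn j h
      c-yes j {R} eq = cong (if_then sgn j h else 0ℤ) (dec-true (partner j P ≟ᵖ R) eq)

      c-no : ∀ j {R} → partner j P ≢ R → c j R ≡ 0ℤ
      c-no j {R} ≢R = cong (if_then sgn j h else 0ℤ) (dec-false (partner j P ≟ᵖ R) ≢R)

      split : ∀ R → factorWeight h (proj₁ R) (join P R) ≡ ∑ factors (λ j → c j R)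
      split R with join P R in eq
      ... | inj₁ j = sym (trans
        (∑-single factors j (λ i i≢j → c-no i (λ { refl → i≢j (inj₁-injective (trans (sym (partner-absorb P i)) eq)) })))
        (c-yes j (inj₂-injective (trans (cong (op P) (sym eq)) (join-absorb P R)))))
      ... | inj₂ _ = sym (sum-zero (λ i → c-no (to factors i) (λ { refl →
        contradiction (trans (sym (partner-absorb P (to factors i))) eq) λ () })))

      inner : ∀ j → ∑ points (c j) ≡ sgn j h
      inner j = trans (∑-single points (partner j P) (λ R R≢ → c-no j (R≢ ∘ sym))) (c-yes j refl)

    -- The points of each quarter are reindexed by their difference from x; triangles occur only at
    -- differences -1, 0, 1, where `table-weight` applies.
    sum-triangleWeight : ∀ P →
      ∑ points (λ R → triangleWeight (proj₁ P) (proj₁ R) (join P R)) ≡ - χ α (proj₁ P) + - χ α (proj₁ P)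
    sum-triangleWeight P@(h , x) = begin
      ∑ points (λ R → triangleWeight h (proj₁ R) (join P R))
        ≡⟨ ∑-× eQ eG (λ R → triangleWeight h (proj₁ R) (join P R)) ⟩
      sum (λ k → sum (λ y → triangleWeight h k (join P (k , y))))
        ≡⟨ sum-cong by-shift ⟩
      sum (λ k → sum (λ s → thirdWeight h k (table p h k s)))
        ≡⟨ table-weight p h ⟩
      - χ α h + - χ α h
        ∎
      where
      open ≡-Reasoning

      neighbours : (Shift ⊎ O) ↔ G
      neighbours = mk↔ₛ′ (λ c → x ⊕ emb c) (λ y → cl (y ⊖ x))
        (λ y → sym (y≡x⊕cl x y)) (λ c → trans (cong cl (x⊕y⊖x x (emb c))) (cl-emb c))

      at-class : ∀ k c → ℤ
      at-class k = [ (λ s → thirdWeight h k (table p h k s)) , (λ _ → 0ℤ) ]′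

      joinAt-weight : ∀ k y c → triangleWeight h k (joinAt P (k , y) c) ≡ at-class k c
      joinAt-weight k y (inj₁ s) with table p h k s
      ... | third _ _ = refl
      ... | reflect   = refl
      ... | extra _   = refl
      joinAt-weight k y (inj₂ o) with far h k
      ... | same          = refl
      ... | apart _ true  = refl
      ... | apart _ false = refl

      by-shift : ∀ k →
        sum (λ y → triangleWeight h k (join P (k , y))) ≡ sum (λ s → thirdWeight h k (table p h k s))
      by-shift k = begin
        sum (λ y → triangleWeight h k (join P (k , y)))
          ≡⟨ ∑-reindex (eS ⊎ᶠ eO) eG neighbours (λ y → triangleWeight h k (join P (k , y))) ⟩
        ∑ (eS ⊎ᶠ eO) (λ c → triangleWeight h k (join P (k , x ⊕ emb c)))
          ≡⟨ ∑-⊎ eS eO (λ c → triangleWeight h k (join P (k , x ⊕ emb c))) ⟩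
        sum (λ s → triangleWeight h k (join P (k , x ⊕ ⟦ s ⟧))) +
        sum (λ o → triangleWeight h k (join P (k , x ⊕ emb (inj₂ o))))
          ≡⟨ cong₂ _+_ (sum-cong (λ s → at (inj₁ s))) (sum-zero (λ o → at (inj₂ o))) ⟩
        sum (λ s → thirdWeight h k (table p h k s)) + 0ℤ
          ≡⟨ ℤₚ.+-identityʳ _ ⟩
        sum (λ s → thirdWeight h k (table p h k s))
          ∎
        where
        at : ∀ c → triangleWeight h k (join P (k , x ⊕ emb c)) ≡ at-class k c
        at c = trans (cong (triangleWeight h k) (join-at c refl)) (joinAt-weight k _ c)

    weight-comm : ∀ P R →
      weight (proj₁ P) (proj₁ R) (join P R) ≡ weight (proj₁ R) (proj₁ P) (join R P)
    weight-comm P R rewrite join-comm R P with join P R in eq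
    ... | inj₂ (l , _) = sym (ω-comm (proj₁ P) (proj₁ R) l)
    ... | inj₁ j with refl ← inj₂-injective (trans (cong (op P) (sym eq)) (join-absorb P R)) = sym (sgn-partner j P)

    weight-range : ∀ P R → P ≢ R → ℤ.∣ weight (proj₁ P) (proj₁ R) (join P R) ∣ ≡ 1
    weight-range P@(h , x) R@(k , y) P≢R = by-class (cl (y ⊖ x)) (y≡x⊕cl x y)
      where
      by-class : ∀ c → y ≡ x ⊕ emb c → ℤ.∣ weight h k (joinAt P R c) ∣ ≡ 1
      by-class (inj₁ s) y≡ with table p h k s | table-sound p h k s
      ... | third l e | _ , _ , inj₂ ω≡1 = ω≡1
      ... | third l e | _ , _ , inj₁ refl = contradiction
        (cong (h ,_) (sym (trans y≡ (trans (cong (x ⊕_) class-○) (identityʳ x))))) P≢R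
      ... | reflect   | _ = ∣sgn∣≡1 (reflection (x ⊕ y)) h
      ... | extra i   | _ = ∣sgn∣≡1 (special i) h
      by-class (inj₂ o) _ with far h k
      ... | same          = ∣sgn∣≡1 (reflection (x ⊕ y)) h
      ... | apart c true  = ∣sgn∣≡1 (translation c o) h
      ... | apart c false = ∣sgn∣≡1 (translation c (negFar o)) h

    -- For each fixed element of the group the four quarters already cancel, because the characters
    -- are balanced.
    sum-sgn-points : ∀ j → ∑ points (λ P → sgn j (proj₁ P)) ≡ 0ℤ
    sum-sgn-points j = trans (∑-× eQ eG (λ P → sgn j (proj₁ P)))
      (trans (∑-comm {4} {m} (λ h _ → sgn j h)) (sum-zero {m} (λ _ → balanced j)))
      where
      scale : ∀ a c → sum (λ h → a * χ c h) ≡ 0ℤ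
      scale a c = trans (sym (*-distribˡ-sum a (χ c))) (trans (cong (a *_) (sum-χ c)) (ℤₚ.*-zeroʳ a))
      balanced : ∀ j → sum (sgn j) ≡ 0ℤ
      balanced (reflection c)    = scale (alt c) α
      balanced (translation c o) = scale (alt o) c
      balanced (special i)       = scale (extraSign p i) (extraClass p i)

    -- The extended quasigroup

    extension : ∀ {k} → 2 ℕ.≤ k → FlowQuasigroup k factors → FlowQuasigroup k (factors ⊎ᶠ points)
    extension {k} 2≤k F = record
      { _∙_ = mul ; idem = mul-idem ; comm = mul-comm ; absorb = mul-absorb
      ; w = wt ; w-diag = wt-diag ; w-sym = wt-sym ; w-third = wt-third ; w-range = wt-range ; w-sum = wt-sum }
      where
      open FlowQuasigroup F

      mul : Factor ⊎ Point → Factor ⊎ Point → Factor ⊎ Point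
      mul (inj₁ i) (inj₁ j) = inj₁ (i ∙ j)
      mul (inj₁ j) (inj₂ P) = inj₂ (partner j P)
      mul (inj₂ P) r        = op P r

      wt : Factor ⊎ Point → Factor ⊎ Point → ℤ
      wt (inj₁ i) (inj₁ j) = w i j
      wt (inj₁ j) (inj₂ P) = sgn j (proj₁ P)
      wt (inj₂ P) (inj₁ j) = sgn j (proj₁ P)
      wt (inj₂ P) (inj₂ R) = weight (proj₁ P) (proj₁ R) (join P R)

      mul-idem : ∀ a → mul a a ≡ a
      mul-idem (inj₁ j) = cong inj₁ (idem j)
      mul-idem (inj₂ P) = join-diag P

      mul-comm : ∀ a b → mul a b ≡ mul b a
      mul-comm (inj₁ i) (inj₁ j) = cong inj₁ (comm i j)
      mul-comm (inj₁ j) (inj₂ P) = refl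
      mul-comm (inj₂ P) (inj₁ j) = refl
      mul-comm (inj₂ P) (inj₂ R) = join-comm P R

      mul-absorb : ∀ a b → mul a (mul a b) ≡ b
      mul-absorb (inj₁ i) (inj₁ j) = cong inj₁ (absorb i j)
      mul-absorb (inj₁ j) (inj₂ P) = cong inj₂ (partner-involutive j P)
      mul-absorb (inj₂ P) (inj₁ j) = partner-absorb P j
      mul-absorb (inj₂ P) (inj₂ R) = join-absorb P R

      wt-diag : ∀ a → wt a a ≡ 0ℤ
      wt-diag (inj₁ j) = w-diag j
      wt-diag (inj₂ P) = trans (cong (weight (proj₁ P) (proj₁ P)) (join-diag P)) (ω-diag (proj₁ P))

      wt-sym : ∀ a b → wt a b ≡ wt b a
      wt-sym (inj₁ i) (inj₁ j) = w-sym i j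
      wt-sym (inj₁ j) (inj₂ P) = refl
      wt-sym (inj₂ P) (inj₁ j) = refl
      wt-sym (inj₂ P) (inj₂ R) = weight-comm P R

      wt-third : ∀ a b → wt a (mul a b) ≡ wt a b
      wt-third (inj₁ i) (inj₁ j) = w-third i j
      wt-third (inj₁ j) (inj₂ P) = sgn-partner j P
      wt-third (inj₂ P) (inj₁ j) = cong (weight (proj₁ P) _) (partner-absorb P j)
      wt-third (inj₂ P) (inj₂ R) with join P R in eq
      ... | inj₁ j = refl
      ... | inj₂ T = trans (cong (weight (proj₁ P) (proj₁ T)) (trans (cong (op P) (sym eq)) (join-absorb P R)))
                           (ω-swap (proj₁ P) (proj₁ R) (proj₁ T))

      unit-range : ∀ {a} → a ≡ 1 → 1 ℕ.≤ a × a ℕ.< k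
      unit-range refl = ℕ.s≤s ℕ.z≤n , 2≤k

      wt-range : ∀ {a b} → a ≢ b → 1 ℕ.≤ ℤ.∣ wt a b ∣ × ℤ.∣ wt a b ∣ ℕ.< k
      wt-range {inj₁ i} {inj₁ j} i≢j = w-range (i≢j ∘ cong inj₁)
      wt-range {inj₁ j} {inj₂ P} _   = unit-range (∣sgn∣≡1 j (proj₁ P))
      wt-range {inj₂ P} {inj₁ j} _   = unit-range (∣sgn∣≡1 j (proj₁ P))
      wt-range {inj₂ P} {inj₂ R} P≢R = unit-range (weight-range P R (P≢R ∘ cong inj₂))

      wt-sum : ∀ a → ∑ (factors ⊎ᶠ points) (wt a) ≡ 0ℤ
      wt-sum (inj₁ j) = trans (∑-⊎ factors points (wt (inj₁ j))) (cong₂ _+_ (w-sum j) (sum-sgn-points j))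
      wt-sum (inj₂ P) = begin
        ∑ (factors ⊎ᶠ points) (wt (inj₂ P))
          ≡⟨ ∑-⊎ factors points (wt (inj₂ P)) ⟩
        ∑ factors (λ j → sgn j h) + ∑ points (λ R → weight h (proj₁ R) (join P R))
          ≡⟨ cong₂ _+_ (sum-sgn h) (trans
               (sum-cong (λ i → weight-split h (proj₁ (to points i)) (join P (to points i))))
               (trans (∑-distrib-+ (λ i → triangleWeight h (proj₁ (to points i)) (join P (to points i))) _)
                      (cong₂ _+_ (sum-triangleWeight P) (sum-factorWeight P)))) ⟩
        -- A block through P and an old point is counted once in each of the two sums, and a
        -- triangle twice in the second.
        χ α h + (- χ α h + - χ α h + χ α h)
          ≡⟨ cong (χ α h +_) (trans (ℤₚ.+-assoc (- χ α h) _ _)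
               (trans (cong (- χ α h +_) (ℤₚ.+-inverseˡ (χ α h))) (ℤₚ.+-identityʳ _))) ⟩
        χ α h + - χ α h
          ≡⟨ ℤₚ.+-inverseʳ (χ α h) ⟩
        0ℤ
          ∎
        where
        open ≡-Reasoning
        h = proj₁ P

    extensionᶠ : ∀ {k} → 2 ℕ.≤ k → FlowQuasigroup k (↔-id (Fin (m ℕ.+ (3 ℕ.* M ℕ.+ 2)))) →
                 FlowQuasigroup k (↔-id (Fin (m ℕ.+ (3 ℕ.* M ℕ.+ 2) ℕ.+ 4 ℕ.* m)))
    extensionᶠ 2≤k F = transport (factors ⊎ᶠ points) (↔-id _) (↔-sym (factors ⊎ᶠ points))
      (extension 2≤k (transport (↔-id _) factors factors F))

open Summation
open Designs
open Pattern using (↓; ○; ↑; odd; even; surplus)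
open Doubling
open import Algebra.Bundles using (AbelianGroup)
open import Algebra.Structures using (IsAbelianGroup)
import Algebra.Properties.AbelianGroup as GroupProperties
open import Data.Fin using (Fin; zero; suc; toℕ)
open import Data.Fin.Properties using (toℕ-injective; toℕ<n; toℕ-fromℕ<; +↔⊎)
open import Data.Integer as ℤ using (1ℤ; -_)
import Data.Integer.Properties as ℤₚ
open import Data.Nat as ℕ using (ℕ; zero; suc; _+_; _*_; _∸_; _/_; _%_; _≤_; _<_; s≤s)
open import Data.Nat.DivMod using (_mod_; m%n<n; %-distribˡ-+; m<n⇒m%n≡m; n%n≡0; m≡m%n+[m/n]*n)
import Data.Nat.Properties as ℕₚ
open import Data.Nat.Solver using (module +-*-Solver)
open import Data.Product using (∃; _,_; proj₁; proj₂)
open import Function using (_↔_; mk↔ₛ′)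
open import Function.Construct.Composition using (_↔-∘_)
open import Function.Construct.Identity using (↔-id)
open import Function.Construct.Symmetry using (↔-sym)
open import Relation.Binary.PropositionalEquality
open import Relation.Nullary using (contradiction)

-- Cyclic groups

module Cyclic (m : ℕ) where
  private
    n = suc m

  infixl 6 _⊕_
  infix 8 ⊝_

  _⊕_ : Fin n → Fin n → Fin n
  i ⊕ j = (toℕ i + toℕ j) mod n

  ⊝_ : Fin n → Fin n
  ⊝ i = (n ∸ toℕ i) mod n

  toℕ-mod : ∀ a → toℕ (a mod n) ≡ a % n
  toℕ-mod a = toℕ-fromℕ< (m%n<n a n)

  mod-toℕ : ∀ i → toℕ i mod n ≡ i
  mod-toℕ i = toℕ-injective (trans (toℕ-mod (toℕ i)) (m<n⇒m%n≡m (toℕ<n i)))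

  mod-+ : ∀ a b → a mod n ⊕ b mod n ≡ (a + b) mod n
  mod-+ a b = toℕ-injective (begin
    toℕ (a mod n ⊕ b mod n)                    ≡⟨ toℕ-mod (toℕ (a mod n) + toℕ (b mod n)) ⟩
    (toℕ (a mod n) + toℕ (b mod n)) % n        ≡⟨ cong₂ (λ x y → (x + y) % n) (toℕ-mod a) (toℕ-mod b) ⟩
    (a % n + b % n) % n                        ≡⟨ %-distribˡ-+ a b n ⟨
    (a + b) % n                                ≡⟨ toℕ-mod (a + b) ⟨
    toℕ ((a + b) mod n)                        ∎)
    where open ≡-Reasoning

  ⊕-comm : ∀ i j → i ⊕ j ≡ j ⊕ i
  ⊕-comm i j = cong (_mod n) (ℕₚ.+-comm (toℕ i) (toℕ j))

  ⊕-assoc : ∀ i j k → (i ⊕ j) ⊕ k ≡ i ⊕ (j ⊕ k)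
  ⊕-assoc i j k = begin
    (i ⊕ j) ⊕ k                       ≡⟨ cong ((i ⊕ j) ⊕_) (mod-toℕ k) ⟨
    (i ⊕ j) ⊕ toℕ k mod n             ≡⟨ mod-+ (toℕ i + toℕ j) (toℕ k) ⟩
    (toℕ i + toℕ j + toℕ k) mod n     ≡⟨ cong (_mod n) (ℕₚ.+-assoc (toℕ i) (toℕ j) (toℕ k)) ⟩
    (toℕ i + (toℕ j + toℕ k)) mod n   ≡⟨ mod-+ (toℕ i) (toℕ j + toℕ k) ⟨
    toℕ i mod n ⊕ (j ⊕ k)             ≡⟨ cong (_⊕ (j ⊕ k)) (mod-toℕ i) ⟩
    i ⊕ (j ⊕ k)                       ∎
    where open ≡-Reasoning

  ⊕-identityˡ : ∀ i → zero ⊕ i ≡ i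
  ⊕-identityˡ = mod-toℕ

  ⊕-inverseˡ : ∀ i → ⊝ i ⊕ i ≡ zero
  ⊕-inverseˡ i = begin
    ⊝ i ⊕ i                          ≡⟨ cong (⊝ i ⊕_) (mod-toℕ i) ⟨
    ⊝ i ⊕ toℕ i mod n                ≡⟨ mod-+ (n ∸ toℕ i) (toℕ i) ⟩
    (n ∸ toℕ i + toℕ i) mod n        ≡⟨ cong (_mod n) (ℕₚ.m∸n+n≡m (ℕₚ.<⇒≤ (toℕ<n i))) ⟩
    n mod n                          ≡⟨ toℕ-injective (trans (toℕ-mod n) (n%n≡0 n)) ⟩
    zero                             ∎
    where open ≡-Reasoning

  isAbelianGroup : IsAbelianGroup _≡_ _⊕_ zero ⊝_
  isAbelianGroup = record
    { isGroup = record
      { isMonoid = record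
        { isSemigroup = record
          { isMagma = record { isEquivalence = isEquivalence ; ∙-cong = cong₂ _⊕_ }
          ; assoc   = ⊕-assoc }
        ; identity = ⊕-identityˡ , λ i → trans (⊕-comm i zero) (⊕-identityˡ i) }
      ; inverse = ⊕-inverseˡ , λ i → trans (⊕-comm i (⊝ i)) (⊕-inverseˡ i)
      ; ⁻¹-cong = cong ⊝_ }
    ; comm = ⊕-comm }

  abelianGroup : AbelianGroup _ _
  abelianGroup = record { isAbelianGroup = isAbelianGroup }

cyclic : ∀ M → PointGroup M (3 + M)
cyclic M = record
  { _⊕_ = _⊕_ ; 𝟘 = zero ; ⊝_ = ⊝_ ; isAbelianGroup = isAbelianGroup
  -- Subtracting one turns the codes 0, 1, 2 of the shifts into the differences -1, 0, 1.
  ; classes = translate ↔-∘ ↔-sym (+↔⊎ {3} {M})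
  ; class-○ = inverseʳ one
  ; class-neg = λ { ↓ → two-one
                  ; ○ → trans (inverseʳ one) (sym (trans (cong ⊝_ (inverseʳ one)) ε⁻¹≈ε))
                  ; ↑ → trans (identityˡ (⊝ one)) (sym (cong ⊝_ (two-one′))) } }
  where
  open Cyclic (2 + M)
  open IsAbelianGroup isAbelianGroup using (inverseˡ; inverseʳ; identityˡ; identityʳ; assoc)
  open GroupProperties abelianGroup using (ε⁻¹≈ε; ⁻¹-involutive)
  one two : Fin (3 + M)
  one = suc zero
  two = suc (suc zero)
  translate : Fin (3 + M) ↔ Fin (3 + M)
  translate = mk↔ₛ′ (_⊕ ⊝ one) (_⊕ one)
    (λ i → trans (assoc i one (⊝ one)) (trans (cong (i ⊕_) (inverseʳ one)) (identityʳ i)))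
    (λ i → trans (assoc i (⊝ one) one) (trans (cong (i ⊕_) (inverseˡ one)) (identityʳ i)))
  two-one′ : two ⊕ ⊝ one ≡ one
  -- By definition `one ⊕ one` is 2 mod n, which `mod-toℕ` identifies with `two`.
  two-one′ = trans (cong (_⊕ ⊝ one) (sym (mod-toℕ two))) (trans (assoc one one (⊝ one))
    (trans (cong (one ⊕_) (inverseʳ one)) (identityʳ one)))
  two-one : two ⊕ ⊝ one ≡ ⊝ (zero ⊕ ⊝ one)
  two-one = trans two-one′ (sym (trans (cong ⊝_ (identityˡ (⊝ one))) (⁻¹-involutive one)))

-- Alternating sums and the choice of parameters

sum-alt-suc : ∀ n → sum (alt {suc n}) ≡ 1ℤ ℤ.+ - sum (alt {n})
sum-alt-suc n = cong (ℤ._+_ 1ℤ) (sum-neg {n} alt)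
  where
  sum-neg : ∀ {n} (f : Fin n → ℤ.ℤ) → sum (λ i → - f i) ≡ - sum f
  sum-neg {zero}  f = refl
  sum-neg {suc n} f = trans (cong (ℤ._+_ (- f zero)) (sum-neg (λ i → f (suc i)))) (sym (ℤₚ.neg-distrib-+ (f zero) _))

-- The sums run 0, 1, 0, 1, .... They start at `odd` because the parity is that of m = 3 + M,
-- opposite to that of M.
alt-parity : ∀ n → ∃ λ p → sum (alt {n}) ≡ surplus p
alt-parity zero = odd , refl
alt-parity (suc n) with alt-parity n
... | odd  , eq = even , trans (sum-alt-suc n) (cong (λ z → 1ℤ ℤ.+ - z) eq)
... | even , eq = odd  , trans (sum-alt-suc n) (cong (λ z → 1ℤ ℤ.+ - z) eq)

extend-quasigroup : ∀ M {k} p → sum (alt {M}) ≡ surplus p → 2 ≤ k →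
                    FlowQuasigroup k (↔-id (Fin (3 + M + (3 * M + 2)))) →
                    FlowQuasigroup k (↔-id (Fin (3 + M + (3 * M + 2) + 4 * (3 + M))))
extend-quasigroup M p Σ≡ = Construction.extensionᶠ (cyclic M) p Σ≡ Σ₃≡
  where
  Σ₃≡ : sum (alt {3 + M}) ≡ 1ℤ ℤ.+ - surplus p
  -- Each further term replaces the sum s by 1 - s; two of the three replacements cancel.
  Σ₃≡ = trans (sum-alt-suc (2 + M)) (cong (λ z → 1ℤ ℤ.+ - z) (trans (sum-alt-suc (1 + M))
    (trans (cong (λ z → 1ℤ ℤ.+ - z) (trans (sum-alt-suc M) (cong (λ z → 1ℤ ℤ.+ - z) Σ≡))) (involutive p))))
    where
    involutive : ∀ p → 1ℤ ℤ.+ - (1ℤ ℤ.+ - surplus p) ≡ surplus p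
    involutive odd  = refl
    involutive even = refl

extend : ∀ M {k} → 2 ≤ k → let v = 3 + M + (3 * M + 2) in
         ∃ (λ (D : STS v) → ZeroSumFlow D k) → ∃ (λ (D : STS (v + 4 * (3 + M))) → ZeroSumFlow D k)
extend M 2≤k (D , F) = design Q , design-flow Q
  where
  Q = extend-quasigroup M (proj₁ (alt-parity M)) (proj₂ (alt-parity M)) 2≤k (quasigroup D F)

-- With v = 4q + 1 the witness is M = q - 1, where q = 0 would give v = 1. The right side counts the
-- factors: 3 + M reflections, 3M translations and 2 extra ones.
9<v⇒v≡ : ∀ v → 9 < v → v % 4 ≡ 1 → ∃ λ M → v ≡ 3 + M + (3 * M + 2)
9<v⇒v≡ v 9<v v%4≡1 = go (v / 4) (trans (m≡m%n+[m/n]*n v 4) (cong (_+ v / 4 * 4) v%4≡1))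
  where
  go : ∀ q → v ≡ 1 + q * 4 → ∃ λ M → v ≡ 3 + M + (3 * M + 2)
  go zero    v≡   = contradiction (subst (9 <_) v≡ 9<v) λ { (s≤s ()) }
  go (suc q) v≡   = q , trans v≡
    (solve 1 (λ q → con 1 :+ (con 1 :+ q) :* con 4 := con 3 :+ q :+ (con 3 :* q :+ con 2)) refl q)
    where open +-*-Solver

theorem2 : ∀ (v : ℕ) → 9 < v → v % 4 ≡ 1 →
    ∀ (k : ℕ) → 2 ≤ k →
    ∃ (λ (D : STS v) → ZeroSumFlow D k) →
    ∃ (λ (D : STS (2 * v + 7)) → ZeroSumFlow D k)
theorem2 v 9<v v%4≡1 k 2≤k DF with 9<v⇒v≡ v 9<v v%4≡1
... | M , refl = subst (λ N → ∃ λ (D : STS N) → ZeroSumFlow D k)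
  -- With m = 3 + M, v = 4m - 7 gives v + 4m = 2v + 7.
  (solve 1 (λ M → con 3 :+ M :+ (con 3 :* M :+ con 2) :+ con 4 :* (con 3 :+ M)
               := con 2 :* (con 3 :+ M :+ (con 3 :* M :+ con 2)) :+ con 7) refl M)
  (extend M 2≤k DF)
  where open +-*-Solver
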